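{- For every fixed positive integer $c$, the problem $(c,k)$-Load Coloring, parameterized by $k$ (with $k\ge 1$), admits a kernel with less than $f(2c,k,2ck)=16c^{2}k-6ck$ edges, where $f(c,k,n)=(2c-1)ck+2n(c-1)$.
   Context: Graphs are finite, simple and undirected; $[c]=\{1,\dots,c\}$. $(c,k)$-Load Coloring: given a graph $G=(V,E)$, a positive integer $c$ and a nonnegative integer $k$, decide whether there is a map $\varphi:V\to[c]$ such that for every $i\in[c]$ at least $k$ edges have both endvertices colored $i$. Write $G\in(c,k)$-LCP if such a $\varphi$ exists. Here $c$ is fixed and $k$ is the parameter. Kernel: the problem (for fixed $c$) admits a kernel with less than $s(k)$ edges if there is a polynomial-time algorithm mapping each instance $(G,k)$ to an instance $(G',k')$ of the same problem such that $G\in(c,k)$-LCP if and only if $G'\in(c,k')$-LCP, $k'\le g(k)$ and the size of $G'$ is at most $g(k)$ for some function $g$ of $k$ only, and $|E(G')|<s(k)$. -}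

module Defs where

open import Data.Bool using (Bool; true; false; if_then_else_)
import Data.Bool.Properties as Bool
open import Data.Fin using (Fin)
import Data.Fin.Properties as Fin
open import Data.List using (List; []; _∷_; allFin; cartesianProduct; filter; length; map; tabulate)
open import Data.Nat using (ℕ; zero; suc; _+_; _*_; _∸_; _^_; _≤_; _<_; ⌊_/2⌋)
open import Data.Nat.ListAction using (sum)
open import Data.Nat.Logarithm using (⌊log₂_⌋)
open import Data.Product using (Σ-syntax; ∃-syntax; _×_; _,_)
open import Data.Sum using (_⊎_; inj₁; inj₂)
open import Data.Unit using (⊤; tt)
open import Function.Bundles using (_⇔_)
open import Relation.Binary.PropositionalEquality using (_≡_)
open import Relation.Nullary.Decidable using (_×-dec_)

record Graph : Set where
  field
    order   : ℕ
    adj     : Fin order → Fin order → Bool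
    adj-sym : ∀ u v → adj u v ≡ adj v u
    no-loop : ∀ v → adj v v ≡ false

open Graph public

-- Each edge {u , v} is listed once, as the pair with u < v.
edges : (G : Graph) → List (Fin (order G) × Fin (order G))
edges G =
  filter (λ (u , v) → (u Fin.<? v) ×-dec (adj G u v Bool.≟ true))
         (cartesianProduct (allFin (order G)) (allFin (order G)))

∣E∣ : Graph → ℕ
∣E∣ G = length (edges G)

graphSize : Graph → ℕ
graphSize G = order G + ∣E∣ G

load : ∀ {c} (G : Graph) → (Fin (order G) → Fin c) → Fin c → ℕ
load G φ i =
  length (filter (λ (u , v) → (φ u Fin.≟ i) ×-dec (φ v Fin.≟ i)) (edges G))

record Instance : Set where
  field
    graph : Graph
    param : ℕ
    1≤k   : 1 ≤ param

open Instance public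

LCP : ℕ → ℕ → Graph → Set
LCP c k G = Σ[ φ ∈ (Fin (order G) → Fin c) ] (∀ i → k ≤ load G φ i)

_∈LCP_ : Instance → ℕ → Set
I ∈LCP c = LCP c (param I) (graph I)

-- The machine model is a small typed language with general iteration and
-- a logarithmic-cost step count: numbers are measured by their binary
-- length, and each step is charged at least for the data it reads and
-- writes, so costs agree with Turing machine time up to a polynomial.

infixr 6 _⊕_
infixr 7 _⊗_

data Ty : Set where
  unit nat : Ty
  _⊕_ _⊗_  : Ty → Ty → Ty
  list     : Ty → Ty

⟦_⟧ : Ty → Set
⟦ unit ⟧   = ⊤
⟦ nat ⟧    = ℕ
⟦ A ⊕ B ⟧  = ⟦ A ⟧ ⊎ ⟦ B ⟧
⟦ A ⊗ B ⟧  = ⟦ A ⟧ × ⟦ B ⟧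
⟦ list A ⟧ = List ⟦ A ⟧

size : (A : Ty) → ⟦ A ⟧ → ℕ
size unit     _        = 1
size nat      n        = suc ⌊log₂ n ⌋
size (A ⊕ B)  (inj₁ a) = suc (size A a)
size (A ⊕ B)  (inj₂ b) = suc (size B b)
size (A ⊗ B)  (a , b)  = suc (size A a + size B b)
size (list A) xs       = suc (sum (map (λ x → suc (size A x)) xs))

data Prim : Ty → Ty → Set where
  idₚ    : ∀ {A} → Prim A A
  fst    : ∀ {A B} → Prim (A ⊗ B) A
  snd    : ∀ {A B} → Prim (A ⊗ B) B
  unitₚ  : ∀ {A} → Prim A unit
  inl    : ∀ {A B} → Prim A (A ⊕ B)
  inr    : ∀ {A B} → Prim B (A ⊕ B)
  nil    : ∀ {A B} → Prim A (list B)
  cons   : ∀ {A} → Prim (A ⊗ list A) (list A)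
  uncons : ∀ {A} → Prim (list A) (unit ⊕ A ⊗ list A)
  lit    : ∀ {A} → ℕ → Prim A nat
  add    : Prim (nat ⊗ nat) nat
  monus  : Prim (nat ⊗ nat) nat
  half   : Prim nat nat
  isZero : Prim nat (unit ⊕ unit)

run : ∀ {A B} → Prim A B → ⟦ A ⟧ → ⟦ B ⟧
run idₚ     x        = x
run fst     (x , _)  = x
run snd     (_ , y)  = y
run unitₚ   _        = tt
run inl     x        = inj₁ x
run inr     y        = inj₂ y
run nil     _        = []
run cons    (x , xs) = x ∷ xs
run uncons  []       = inj₁ tt
run uncons  (x ∷ xs) = inj₂ (x , xs)
run (lit n) _        = n
run add     (m , n)  = m + n
run monus   (m , n)  = m ∸ n
run half    n        = ⌊ n /2⌋
run isZero  zero     = inj₁ tt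
run isZero  (suc _)  = inj₂ tt

infixl 5 _⨾_

data Prog : Ty → Ty → Set where
  prim : ∀ {A B} → Prim A B → Prog A B
  _⨾_  : ∀ {A B C} → Prog A B → Prog B C → Prog A C
  pair : ∀ {A B C} → Prog A B → Prog A C → Prog A (B ⊗ C)
  case : ∀ {A B Γ C} → Prog (A ⊗ Γ) C → Prog (B ⊗ Γ) C → Prog ((A ⊕ B) ⊗ Γ) C
  iter : ∀ {A B} → Prog A (A ⊕ B) → Prog A B

infix 4 _⊢_⇓_[_]

-- p ⊢ x ⇓ y [ t ]: on input x, p halts with output y at cost t.
data _⊢_⇓_[_] : ∀ {A B} → Prog A B → ⟦ A ⟧ → ⟦ B ⟧ → ℕ → Set where
  ⇓prim : ∀ {A B} {p : Prim A B} {x} →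
          prim p ⊢ x ⇓ run p x [ suc (size A x + size B (run p x)) ]
  ⇓seq  : ∀ {A B C} {p : Prog A B} {q : Prog B C} {x y z s t} →
          p ⊢ x ⇓ y [ s ] → q ⊢ y ⇓ z [ t ] →
          p ⨾ q ⊢ x ⇓ z [ suc (s + t) ]
  ⇓pair : ∀ {A B C} {p : Prog A B} {q : Prog A C} {x y z s t} →
          p ⊢ x ⇓ y [ s ] → q ⊢ x ⇓ z [ t ] →
          pair p q ⊢ x ⇓ (y , z) [ suc (size A x + (s + t)) ]
  ⇓inj₁ : ∀ {A B Γ C} {p : Prog (A ⊗ Γ) C} {q : Prog (B ⊗ Γ) C} {a γ y t} →
          p ⊢ (a , γ) ⇓ y [ t ] →
          case p q ⊢ (inj₁ a , γ) ⇓ y [ suc (size ((A ⊕ B) ⊗ Γ) (inj₁ a , γ) + t) ]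
  ⇓inj₂ : ∀ {A B Γ C} {p : Prog (A ⊗ Γ) C} {q : Prog (B ⊗ Γ) C} {b γ y t} →
          q ⊢ (b , γ) ⇓ y [ t ] →
          case p q ⊢ (inj₂ b , γ) ⇓ y [ suc (size ((A ⊕ B) ⊗ Γ) (inj₂ b , γ) + t) ]
  ⇓more : ∀ {A B} {p : Prog A (A ⊕ B)} {x x′ y s t} →
          p ⊢ x ⇓ inj₁ x′ [ s ] → iter p ⊢ x′ ⇓ y [ t ] →
          iter p ⊢ x ⇓ y [ suc (s + t) ]
  ⇓done : ∀ {A B} {p : Prog A (A ⊕ B)} {x y t} →
          p ⊢ x ⇓ inj₂ y [ t ] →
          iter p ⊢ x ⇓ y [ suc t ]

InstTy : Ty
InstTy = list (list (unit ⊕ unit)) ⊗ nat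

-- The adjacency matrix, row by row, together with k.
encode : Instance → ⟦ InstTy ⟧
encode I =
  tabulate (λ u → tabulate (λ v → if adj (graph I) u v then inj₁ tt else inj₂ tt)) ,
  param I

PolyTime : (Instance → Instance) → Set
PolyTime F =
  Σ[ p ∈ Prog InstTy InstTy ] ∃[ a ] ∃[ d ] (∀ I →
    ∃[ t ] (p ⊢ encode I ⇓ encode (F I) [ t ] ×
            t ≤ a * size InstTy (encode I) ^ d))

record AdmitsKernel (c : ℕ) (s : ℕ → ℕ) : Set where
  field
    reduce      : Instance → Instance
    polyTime    : PolyTime reduce
    equivalent  : ∀ I → I ∈LCP c ⇔ reduce I ∈LCP c
    g           : ℕ → ℕ
    param-bound : ∀ I → param (reduce I) ≤ g (param I)
    size-bound  : ∀ I → graphSize (graph (reduce I)) ≤ g (param I)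
    edge-bound  : ∀ I → ∣E∣ (graph (reduce I)) < s (param I)

-- Truncated subtraction is harmless: only c ≥ 1 is used.
f : ℕ → ℕ → ℕ → ℕ
f c k n = (2 * c ∸ 1) * c * k + 2 * n * (c ∸ 1)

{-# OPTIONS --safe #-}
module Submission where

-- Write D = (2c + 1)k. If some vertex w has degree at least D without counting an edge e at w, then
-- deleting e preserves the answer: k edges from each colour class have at most 2ck endpoints, and all
-- vertices apart from these may be given the colour of w. On the other hand, a graph of maximum degree
-- at most D with O(c²k) edges is always a yes-instance, since one can repeatedly split off a vertex set
-- that spans k edges and meets only O(ck) edges. So the kernel collects edges greedily, as long as all
-- degrees stay at most D and the number of edges stays below the second threshold M: if M edges are
-- collected, both instances are positive, and otherwise every rejected edge has an endpoint of degree D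
-- in the kernel, so the rejected edges can be deleted one by one. Isolated vertices are dropped.

open import Defs
open import Data.Bool using (Bool; true; false; if_then_else_; _∧_; _∨_)
import Data.Bool.Properties as Bool
open import Data.Empty using (⊥; ⊥-elim)
open import Data.Fin as Fin using (Fin; toℕ)
import Data.Fin.Properties as Fin
open import Data.List using (List; []; _∷_; [_]; _++_; _ʳ++_; allFin; cartesianProduct; concatMap; filter; foldr; length; lookup; map; reverse; tabulate; take)
open import Data.List.Membership.Propositional using (_∈_)
open import Data.List.Membership.Propositional.Properties
open import Data.List.Membership.Propositional.Properties.WithK using (unique∧set⇒bag)
open import Data.List.Properties
open import Data.List.Relation.Binary.BagAndSetEquality using (∼bag⇒↭)
open import Data.List.Relation.Binary.Permutation.Propositional using (_↭_; ↭-refl)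
open import Data.List.Relation.Binary.Permutation.Propositional.Properties using (↭-length; filter-↭; shift)
open import Data.List.Relation.Binary.Sublist.Propositional using (_⊆_; []; _∷_; _∷ʳ_; ⊆-refl; ⊆-trans)
import Data.List.Relation.Binary.Sublist.Propositional as Sublist
open import Data.List.Relation.Binary.Sublist.Propositional.Properties using (All-resp-⊆; filter-⊆; take-⊆; ++⁺)
open import Data.List.Relation.Unary.All as All using ([]; _∷_)
open import Data.List.Relation.Unary.AllPairs using (AllPairs; []; _∷_)
import Data.List.Relation.Unary.AllPairs.Properties as AllPairs
open import Data.List.Relation.Unary.Any as Any using (Any; any?; here; there)
open import Data.List.Relation.Unary.Any.Properties using (lookup-index)
open import Data.List.Relation.Unary.Unique.Propositional using (Unique)
import Data.List.Relation.Unary.Unique.Propositional.Properties as Unique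
open import Data.Nat
open import Data.Nat.ListAction using (sum)
open import Data.Nat.Logarithm
open import Data.Nat.Properties
open import Data.Nat.Tactic.RingSolver using (solve-∀)
open import Data.List.Membership.DecPropositional _≟_ using (_∈?_)
open import Data.Product using (Σ-syntax; ∃-syntax; ∃₂; _×_; _,_; proj₁; proj₂)
open import Data.Sum as Sum using (_⊎_; inj₁; inj₂; [_,_]′)
open import Data.Unit using (tt)
import Function.Construct.Composition as Composition
import Function.Construct.Symmetry as Symmetry
open import Function using (_∘_; id; const)
open import Function.Bundles using (_⇔_; mk⇔)
open import Function.Definitions using (Injective)
open import Level using (0ℓ)
open import Relation.Binary.Definitions using (tri<; tri≈; tri>)
open import Relation.Binary.PropositionalEquality hiding ([_])
open import Relation.Nullary using (Dec; yes; no; ¬_; contradiction)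
open import Relation.Nullary.Decidable using (_×-dec_; _⊎-dec_; ¬?; toSum; does; dec-true; dec-false)
open import Relation.Unary using (Pred; Decidable)

-- The set to be split off needs a controlled degree sum. Vertices are therefore kept in their
-- numerical order and only intervals are cut: moving a cut past one vertex changes the degree sum
-- by at most D, so some value between L and L + D is always hit. The completion of an initial
-- segment to a set spanning k edges is a pigeonhole argument over windows, and it needs an upper
-- bound on the number of edges as well. This is why collecting stops at M instead of being limited
-- by the degrees alone.
--
-- Degrees are measured among the collected edges and not in the input. The D edges that justify
-- deleting a rejected edge are then never deleted themselves, so the deletions can follow one
-- another.
--
-- For large c the factor 6 in L = 6ck is forced from both sides. With L = xck and D about 2ck, M is
-- about (2x + 4)c²k. To leading order the upper bound on the number of edges asks for x² ≥ 4x + 8,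
-- which fails at x = 5, and staying below 16c²k asks for 2x + 4 ≤ 16.

private variable
  Elt Elt′ : Set
  P Q R : Pred Elt 0ℓ

-- Counting the entries of a list that satisfy a predicate

count : {P : Pred Elt 0ℓ} → Decidable P → List Elt → ℕ
count P? = length ∘ filter P?

module _ {Elt : Set} {P : Pred Elt 0ℓ} (P? : Decidable P) where

  count-accept : ∀ {x xs} → P x → count P? (x ∷ xs) ≡ suc (count P? xs)
  count-accept p = cong length (filter-accept P? p)

  count-reject : ∀ {x xs} → ¬ P x → count P? (x ∷ xs) ≡ count P? xs
  count-reject ¬p = cong length (filter-reject P? ¬p)

  count-++ : ∀ xs ys → count P? (xs ++ ys) ≡ count P? xs + count P? ys
  count-++ xs ys = trans (cong length (filter-++ P? xs ys)) (length-++ (filter P? xs))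

  count-map : (f : Elt′ → Elt) (xs : List Elt′) → count P? (map f xs) ≡ count (P? ∘ f) xs
  count-map f []       = refl
  count-map f (x ∷ xs) with P? (f x)
  ... | yes _ = cong suc (count-map f xs)
  ... | no  _ = count-map f xs

  count-↭ : ∀ {xs ys} → xs ↭ ys → count P? xs ≡ count P? ys
  count-↭ xs↭ys = ↭-length (filter-↭ P? xs↭ys)

  count-total : ∀ xs → (∀ {x} → x ∈ xs → P x) → count P? xs ≡ length xs
  count-total []       _   = refl
  count-total (x ∷ xs) total = trans (count-accept (total (here refl))) (cong suc (count-total xs (total ∘ there)))

count-split : (P? : Decidable P) (Q? : Decidable Q) (R? : Decidable R) (xs : List Elt) →
              (∀ {x} → x ∈ xs → P x → Q x ⊎ R x) →
              count P? xs ≤ count Q? xs + count R? xs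
count-split P? Q? R? []       _   = z≤n
count-split P? Q? R? (x ∷ xs) P⇒Q⊎R
  with IH ← count-split P? Q? R? xs (P⇒Q⊎R ∘ there) | P? x | Q? x | R? x
... | no  _ | no  _ | no  _ = IH
... | no  _ | no  _ | yes _ = ≤-trans IH (+-monoʳ-≤ _ (n≤1+n _))
... | no  _ | yes _ | no  _ = m≤n⇒m≤1+n IH
... | no  _ | yes _ | yes _ = m≤n⇒m≤1+n (≤-trans IH (+-monoʳ-≤ _ (n≤1+n _)))
... | yes _ | yes _ | no  _ = s≤s IH
... | yes _ | yes _ | yes _ = s≤s (≤-trans IH (+-monoʳ-≤ _ (n≤1+n _)))
... | yes _ | no  _ | yes _ = ≤-trans (s≤s IH) (≤-reflexive (sym (+-suc _ _)))
... | yes p | no ¬q | no ¬r = ⊥-elim (Sum.[ ¬q , ¬r ] (P⇒Q⊎R (here refl) p))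

count-disjoint : (P? : Decidable P) (Q? : Decidable Q) (R? : Decidable R) (xs : List Elt) →
                 (∀ {x} → x ∈ xs → Q x ⊎ R x → P x) → (∀ {x} → x ∈ xs → Q x → R x → ⊥) →
                 count Q? xs + count R? xs ≤ count P? xs
count-disjoint P? Q? R? []       _     _    = z≤n
count-disjoint P? Q? R? (x ∷ xs) Q⊎R⇒P disj
  with IH ← count-disjoint P? Q? R? xs (Q⊎R⇒P ∘ there) (disj ∘ there) | P? x | Q? x | R? x
... | _     | yes q | yes r = ⊥-elim (disj (here refl) q r)
... | no ¬p | yes q | no  _ = contradiction (Q⊎R⇒P (here refl) (inj₁ q)) ¬p
... | no ¬p | no  _ | yes r = contradiction (Q⊎R⇒P (here refl) (inj₂ r)) ¬p
... | no  _ | no  _ | no  _ = IH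
... | yes _ | no  _ | no  _ = m≤n⇒m≤1+n IH
... | yes _ | yes _ | no  _ = s≤s IH
... | yes _ | no  _ | yes _ = ≤-trans (≤-reflexive (+-suc _ _)) (s≤s IH)

count-mono : (P? : Decidable P) (Q? : Decidable Q) (xs : List Elt) →
             (∀ {x} → x ∈ xs → P x → Q x) → count P? xs ≤ count Q? xs
count-mono P? Q? []       _   = z≤n
count-mono P? Q? (x ∷ xs) P⇒Q with IH ← count-mono P? Q? xs (P⇒Q ∘ there) | P? x | Q? x
... | no  _ | no  _ = IH
... | no  _ | yes _ = m≤n⇒m≤1+n IH
... | yes _ | yes _ = s≤s IH
... | yes p | no ¬q = contradiction (P⇒Q (here refl) p) ¬q

count-filter⁺ : (P? : Decidable P) (Q? : Decidable Q) (R? : Decidable R) (xs : List Elt) →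
               (∀ {x} → x ∈ xs → P x → Q x → R x) →
               count P? (filter Q? xs) ≤ count R? xs
count-filter⁺ P? Q? R? []       _    = z≤n
count-filter⁺ P? Q? R? (x ∷ xs) PQ⇒R with IH ← count-filter⁺ P? Q? R? xs (PQ⇒R ∘ there) | Q? x | R? x
... | no  _ | no  _ = IH
... | no  _ | yes _ = m≤n⇒m≤1+n IH
... | yes q | R?x with P? x | R?x
...   | no  _ | no  _ = IH
...   | no  _ | yes _ = m≤n⇒m≤1+n IH
...   | yes _ | yes _ = s≤s IH
...   | yes p | no ¬r = contradiction (PQ⇒R (here refl) p q) ¬r

count-filter⁻ : (P? : Decidable P) (Q? : Decidable Q) (R? : Decidable R) (xs : List Elt) →
                (∀ {x} → x ∈ xs → R x → P x × Q x) →
                count R? xs ≤ count P? (filter Q? xs)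
count-filter⁻ P? Q? R? []       _    = z≤n
count-filter⁻ P? Q? R? (x ∷ xs) R⇒PQ with IH ← count-filter⁻ P? Q? R? xs (R⇒PQ ∘ there) | R? x | Q? x
... | no  _ | no  _ = IH
... | yes r | no ¬q = contradiction (proj₂ (R⇒PQ (here refl) r)) ¬q
... | R?x   | yes q with R?x | P? x
...   | no  _ | no  _ = IH
...   | no  _ | yes _ = m≤n⇒m≤1+n IH
...   | yes _ | yes _ = s≤s IH
...   | yes r | no ¬p = contradiction (proj₁ (R⇒PQ (here refl) r)) ¬p

-- Edge lists over ℕ and their degrees

Edge : Set
Edge = ℕ × ℕ

ends : List Edge → List ℕ
ends = concatMap (λ (u , v) → u ∷ v ∷ [])

-- Since degrees are multiplicities in `ends E`, the degree sum of a vertex set is a single `count`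
-- over that list, additive over disjoint sets.
deg : List Edge → ℕ → ℕ
deg E v = count (_≟ v) (ends E)

Oriented : List Edge → Set
Oriented E = ∀ {u v} → (u , v) ∈ E → u < v

count-ends : (P? : Decidable P) (E : List Edge) →
             count P? (ends E) ≡ count (P? ∘ proj₁) E + count (P? ∘ proj₂) E
count-ends P? []            = refl
count-ends P? ((u , v) ∷ E) with IH ← count-ends P? E | P? u
count-ends P? ((u , v) ∷ E) | yes _ with P? v
... | yes _ = cong suc (trans (cong suc IH) (sym (+-suc _ _)))
... | no  _ = cong suc IH
count-ends P? ((u , v) ∷ E) | no _ with P? v
... | yes _ = trans (cong suc IH) (sym (+-suc _ _))
... | no  _ = IH

length-ends : ∀ E → length (ends E) ≡ 2 * length E
length-ends []            = refl
length-ends ((u , v) ∷ E) = trans (cong (2 +_) (length-ends E)) (cong suc (sym (+-suc _ _)))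

-- Intervals with a controlled number of entries

Bounded : ℕ → List ℕ → Set
Bounded n X = ∀ {x} → x ∈ X → x < n

bounded : ∀ X → ∃[ n ] Bounded n X
bounded []      = 0 , λ ()
bounded (x ∷ X) with n , X<n ← bounded X =
  suc x ⊔ n , λ { (here refl) → m≤m⊔n (suc x) n ; (there y∈) → m≤n⇒m≤o⊔n (suc x) (X<n y∈) }

Within : ℕ → ℕ → Pred ℕ 0ℓ
Within a b x = a ≤ x × x < b

within? : ∀ a b → Decidable (Within a b)
within? a b x = (a ≤? x) ×-dec (x <? b)

-- Descend from n as long as the value is at least L. Just above the first value below L, a single
-- step has added at most D. Monotonicity is not assumed.
discreteIVT : ∀ (f : ℕ → ℕ) D L n → (∀ i → f (suc i) ≤ f i + D) → f 0 ≤ L + D → L ≤ f n →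
              ∃[ i ] (L ≤ f i × f i ≤ L + D)
discreteIVT f D L zero    step f0≤ L≤f = 0 , L≤f , f0≤
discreteIVT f D L (suc n) step f0≤ L≤f with L ≤? f n
... | yes L≤fn = discreteIVT f D L n step f0≤ L≤fn
... | no  L≰fn = suc n , L≤f , ≤-trans (step n) (+-monoˡ-≤ D (<⇒≤ (≰⇒> L≰fn)))

module _ (X : List ℕ) (D : ℕ) (mult≤D : ∀ v → count (_≟ v) X ≤ D) where

  -- Lengthening the window by one number adds the multiplicity of that number, which is at most D.
  interval : ∀ a L → L ≤ count (a ≤?_) X →
             ∃[ i ] (L ≤ count (within? a (a + i)) X × count (within? a (a + i)) X ≤ L + D)
  interval a L L≤ = discreteIVT w D L n step w₀ (≤-trans L≤ wₙ)
    where
    n = proj₁ (bounded X)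
    w = λ i → count (within? a (a + i)) X
    step : ∀ i → w (suc i) ≤ w i + D
    step i = ≤-trans
      (count-split (within? a (a + suc i)) (within? a (a + i)) (_≟ (a + i)) X
        λ {x} _ (a≤x , x<) → Sum.map (a≤x ,_) id
          (m≤n⇒m<n∨m≡n (s≤s⁻¹ (≤-trans x< (≤-reflexive (+-suc a i))))))
      (+-monoʳ-≤ (w i) (mult≤D (a + i)))
    w₀ : w 0 ≤ L + D
    w₀ = ≤-trans
      (count-mono (within? a (a + 0)) (_≟ a) X
        λ {x} _ (a≤x , x<) → contradiction (≤-trans x< (≤-reflexive (+-identityʳ a))) (≤⇒≯ a≤x))
      (≤-trans (mult≤D a) (m≤n+m D L))
    wₙ : count (a ≤?_) X ≤ w n
    wₙ = count-mono (a ≤?_) (within? a (a + n)) X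
      λ x∈X a≤x → a≤x , <-≤-trans (proj₂ (bounded X) x∈X) (m≤n+m n a)

  -- Pigeonhole: windows are cut off from the left, each using up at least L entries of `X`. A
  -- window with fewer than k entries of `Y` is discarded, which lowers both hypotheses from q + 1
  -- to q. Once at most L entries of `X` remain, the whole remainder serves as the last window.
  richInterval : ∀ Y L k q a → count (a ≤?_) X ≤ suc q * L → suc q * k ≤ count (a ≤?_) Y →
                 ∃₂ λ b d → count (within? b d) X ≤ L + D × k ≤ count (within? b d) Y
  richInterval Y L k q a X≤ ≤Y with count (a ≤?_) X ≤? L
  -- The last window ends beyond every entry of `Y`. It may miss entries of `X`, for which only an
  -- upper bound is claimed.
  ... | yes X≤L = a , n , ≤-trans Xₐₙ (≤-trans X≤L (m≤m+n L D)) , ≤-trans (m≤m+n k (q * k)) (≤-trans ≤Y Yₐₙ)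
    where
    n = proj₁ (bounded Y)
    Xₐₙ = count-mono (within? a n) (a ≤?_) X λ _ → proj₁
    Yₐₙ = count-mono (a ≤?_) (within? a n) Y λ x∈Y a≤x → a≤x , proj₂ (bounded Y) x∈Y
  richInterval Y L k zero    a X≤ ≤Y | no X≰L = contradiction (≤-trans X≤ (≤-reflexive (*-identityˡ L))) X≰L
  richInterval Y L k (suc q) a X≤ ≤Y | no X≰L
    with i , L≤ , ≤L+D ← interval a L (<⇒≤ (≰⇒> X≰L)) with k ≤? count (within? a (a + i)) Y
  ... | yes k≤ = a , a + i , ≤L+D , k≤
  ... | no  k≰ = richInterval Y L k q (a + i) restX restY
    where
    restX : count ((a + i) ≤?_) X ≤ suc q * L
    restX = +-cancelˡ-≤ L _ _ (≤-trans (+-monoˡ-≤ _ L≤) (≤-trans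
      (count-disjoint (a ≤?_) (within? a (a + i)) ((a + i) ≤?_) X
        (λ _ → Sum.[ proj₁ , ≤-trans (m≤m+n a i) ]) (λ _ (_ , x<) ≤x → <⇒≱ x< ≤x)) X≤))
    restY : suc q * k ≤ count ((a + i) ≤?_) Y
    restY = +-cancelˡ-≤ k _ _ (≤-trans ≤Y (≤-trans
      (count-split (a ≤?_) (within? a (a + i)) ((a + i) ≤?_) Y
        λ {x} _ a≤x → Sum.map (a≤x ,_) id (Sum.swap (≤-<-connex (a + i) x)))
      (+-monoˡ-≤ _ (<⇒≤ (≰⇒> k≰)))))

-- Splitting off a vertex set that spans k edges

Both Either : Pred ℕ 0ℓ → Pred Edge 0ℓ
Both   S (u , v) = S u × S v
Either S (u , v) = S u ⊎ S v

both? : ∀ {S} → Decidable S → Decidable (Both S)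
both? S? (u , v) = S? u ×-dec S? v

either? : ∀ {S} → Decidable S → Decidable (Either S)
either? S? (u , v) = S? u ⊎-dec S? v

touch-≤ : ∀ {S} (S? : Decidable S) E → count (either? S?) E ≤ count S? (ends E)
touch-≤ S? E = ≤-trans (count-split (either? S?) (S? ∘ proj₁) (S? ∘ proj₂) E (λ _ → id))
                       (≤-reflexive (sym (count-ends S? E)))

-- A is an initial segment of the vertices with degree sum about L. If A spans fewer than k edges,
-- then (q + 1)k edges leave it; cutting the remaining vertices into q + 1 intervals of degree sum
-- about L, one of them receives k of these edges.
extract : ∀ E q D k → Oriented E → (∀ v → deg E v ≤ D) →
          let L = (3 + q) * k in
          L ≤ 2 * length E → 2 * length E ≤ (2 + q) * L →
          Σ[ S ∈ Pred ℕ 0ℓ ] Σ[ S? ∈ Decidable S ]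
            (k ≤ count (both? S?) E × count (either? S?) E ≤ (L + D) + (L + D))
extract E q D k or deg≤D L≤2m 2m≤
  with p , L≤ , ≤L+D ← interval (ends E) D deg≤D 0 ((3 + q) * k)
         (≤-trans L≤2m (≤-reflexive (sym (trans (count-total (0 ≤?_) (ends E) (λ _ → z≤n)) (length-ends E)))))
  = cut p (≤-trans L≤ (count-mono (within? 0 p) (_<? p) X λ _ → proj₂))
          (≤-trans (count-mono (_<? p) (within? 0 p) X λ _ x<p → z≤n , x<p) ≤L+D)
  where
  L = (3 + q) * k
  X = ends E
  cut : ∀ p → L ≤ count (_<? p) X → count (_<? p) X ≤ L + D →
        Σ[ S ∈ Pred ℕ 0ℓ ] Σ[ S? ∈ Decidable S ]
          (k ≤ count (both? S?) E × count (either? S?) E ≤ (L + D) + (L + D))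
  cut p L≤A A≤ with k ≤? count (both? (_<? p)) E
  ... | yes k≤ = (_< p) , (_<? p) , k≤ , ≤-trans (touch-≤ (_<? p) E) (≤-trans A≤ (m≤m+n _ _))
  ... | no  k≰ = let a , b , B≤ , k≤B = richInterval X D deg≤D Y L k q p fewX enoughY in
    S a b , S? a b , k≤e a b k≤B ,
    ≤-trans (touch-≤ (S? a b) E)
            (≤-trans (count-split (S? a b) (_<? p) (within? a b) X (λ _ → id)) (+-mono-≤ A≤ B≤))
    where
    e≤k = <⇒≤ (≰⇒> k≰)
    -- Edges inside A contribute entries below p. The lower bound `enoughY` counts only entries from
    -- p on, that is, the crossing edges.
    Y = map proj₂ (filter ((_<? p) ∘ proj₁) E)
    cross? : Decidable (λ (e : Edge) → proj₁ e < p × p ≤ proj₂ e)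
    cross? (u , v) = (u <? p) ×-dec (p ≤? v)
    crossY : count cross? E ≤ count (p ≤?_) Y
    crossY = ≤-trans
      (count-filter⁻ ((p ≤?_) ∘ proj₂) ((_<? p) ∘ proj₁) cross? E λ _ (u<p , p≤v) → p≤v , u<p)
      (≤-reflexive (sym (count-map (p ≤?_) proj₂ (filter ((_<? p) ∘ proj₁) E))))
    left : count ((_<? p) ∘ proj₁) E ≤ count (both? (_<? p)) E + count cross? E
    left = count-split ((_<? p) ∘ proj₁) (both? (_<? p)) cross? E
      λ {(u , v)} _ u<p → Sum.map (u<p ,_) (u<p ,_) (<-≤-connex v p)
    -- Orientation: if the larger end lies below p, so does the smaller one. Hence every edge
    -- leaving A does so through its second component.
    right : count ((_<? p) ∘ proj₂) E ≤ count (both? (_<? p)) E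
    right = count-mono ((_<? p) ∘ proj₂) (both? (_<? p)) E λ e∈ v<p → <-trans (or e∈) v<p , v<p
    -- Edges inside A count twice in its degree sum, crossing edges once. This explains L = (3 +
    -- q)k: at most 2k is spent inside A, and (1 + q)k crossing edges remain.
    degA : count (_<? p) X ≤ k + (k + count cross? E)
    degA = ≤-trans
      (≤-reflexive (trans (count-ends (_<? p) E) (+-comm (count ((_<? p) ∘ proj₁) E) _)))
      (+-mono-≤ (≤-trans right e≤k) (≤-trans left (+-monoˡ-≤ _ e≤k)))
    enoughY : suc q * k ≤ count (p ≤?_) Y
    enoughY = ≤-trans (+-cancelˡ-≤ k _ _ (+-cancelˡ-≤ k _ _ (≤-trans L≤A degA))) crossY
    -- A takes at least L of the total degree sum, which is at most (2 + q)L.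
    fewX : count (p ≤?_) X ≤ suc q * L
    fewX = +-cancelˡ-≤ L _ _ (≤-trans (+-monoˡ-≤ _ L≤A) (≤-trans
      (count-disjoint (0 ≤?_) (_<? p) (p ≤?_) X (λ _ _ → z≤n) (λ _ x<p p≤x → <⇒≱ x<p p≤x))
      (≤-trans (≤-reflexive (trans (count-total (0 ≤?_) X (λ _ → z≤n)) (length-ends E))) 2m≤)))
    S : ℕ → ℕ → Pred ℕ 0ℓ
    S a b x = x < p ⊎ Within a b x
    S? : ∀ a b → Decidable (S a b)
    S? a b x = (x <? p) ⊎-dec within? a b x
    k≤e : ∀ a b → k ≤ count (within? a b) Y → k ≤ count (both? (S? a b)) E
    k≤e a b k≤B = ≤-trans k≤B (≤-trans
      (≤-reflexive (count-map (within? a b) proj₂ (filter ((_<? p) ∘ proj₁) E)))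
      (count-filter⁺ (within? a b ∘ proj₂) ((_<? p) ∘ proj₁) (both? (S? a b)) E
        λ _ v∈B u∈A → inj₁ u∈A , inj₂ v∈B))

-- Sublists and duplicate-free lists

count-⊆ : (P? : Decidable P) {xs ys : List Elt} → xs ⊆ ys → count P? xs ≤ count P? ys
count-⊆ P? []           = z≤n
count-⊆ P? (y ∷ʳ xs⊆ys) with P? y
... | yes _ = m≤n⇒m≤1+n (count-⊆ P? xs⊆ys)
... | no  _ = count-⊆ P? xs⊆ys
count-⊆ P? (_∷_ {x} refl xs⊆ys) with P? x
... | yes _ = s≤s (count-⊆ P? xs⊆ys)
... | no  _ = count-⊆ P? xs⊆ys

unique-⊆ : {xs ys : List Elt} → xs ⊆ ys → Unique ys → Unique xs
unique-⊆ []             _         = []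
unique-⊆ (y ∷ʳ xs⊆ys)   (_ ∷ !ys) = unique-⊆ xs⊆ys !ys
unique-⊆ (refl ∷ xs⊆ys) (y∉ ∷ !ys) = All-resp-⊆ xs⊆ys y∉ ∷ unique-⊆ xs⊆ys !ys

unique-length : {xs ys : List Elt} → Unique xs → (∀ {x} → x ∈ xs → x ∈ ys) → length xs ≤ length ys
unique-length []                   _     = z≤n
unique-length {xs = x ∷ xs} {ys} (x∉xs ∷ !xs) xs⊆ys with as , bs , refl ← ∈-∃++ (xs⊆ys (here refl)) =
  ≤-trans (s≤s (unique-length !xs xs⊆as++bs))
          (≤-reflexive (sym (trans (length-++ as) (trans (+-suc _ _) (cong suc (sym (length-++ as)))))))
  where
  xs⊆as++bs : ∀ {y} → y ∈ xs → y ∈ as ++ bs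
  xs⊆as++bs y∈xs with ∈-++⁻ as (xs⊆ys (there y∈xs))
  ... | inj₁ y∈as          = ∈-++⁺ˡ y∈as
  ... | inj₂ (here refl)   = contradiction refl (All.lookup x∉xs y∈xs)
  ... | inj₂ (there y∈bs)  = ∈-++⁺ʳ as y∈bs

-- Load colourings of edge lists and the many-edges case

mono? : ∀ {c} (φ : ℕ → Fin c) i → Decidable (λ ((u , v) : Edge) → φ u ≡ i × φ v ≡ i)
mono? φ i (u , v) = (φ u Fin.≟ i) ×-dec (φ v Fin.≟ i)

EdgeLCP : ℕ → ℕ → List Edge → Set
EdgeLCP c k E = Σ[ φ ∈ (ℕ → Fin c) ] (∀ i → k ≤ count (mono? φ i) E)

edgeLCP-⊆ : ∀ {c k E F} → E ⊆ F → EdgeLCP c k E → EdgeLCP c k F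
edgeLCP-⊆ E⊆F (φ , k≤) = φ , λ i → ≤-trans (k≤ i) (count-⊆ (mono? φ i) E⊆F)

edgeLCP-↭ : ∀ {c k E F} → E ↭ F → EdgeLCP c k E → EdgeLCP c k F
edgeLCP-↭ E↭F (φ , k≤) = φ , λ i → ≤-trans (k≤ i) (≤-reflexive (count-↭ (mono? φ i) E↭F))

deg-filter : (P? : Decidable P) → ∀ E v → deg (filter P? E) v ≤ deg E v
deg-filter P? E v = begin
  count (_≟ v) (ends (filter P? E))
    ≡⟨ count-ends (_≟ v) (filter P? E) ⟩
  count ((_≟ v) ∘ proj₁) (filter P? E) + count ((_≟ v) ∘ proj₂) (filter P? E)
    ≤⟨ +-mono-≤ (count-⊆ ((_≟ v) ∘ proj₁) (filter-⊆ P? E)) (count-⊆ ((_≟ v) ∘ proj₂) (filter-⊆ P? E)) ⟩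
  count ((_≟ v) ∘ proj₁) E + count ((_≟ v) ∘ proj₂) E
    ≡⟨ count-ends (_≟ v) E ⟨
  deg E v ∎
  where open ≤-Reasoning

-- Each extracted set gets a colour of its own, at the price of the at most 2(L + D) edges that
-- touch it. The remaining edges avoid the set, so recolouring it does not disturb them, and the
-- upper bounds on degrees and on the number of edges pass to sublists. The last colour needs only
-- the k edges left over.
dense : ∀ j E q D k → Oriented E → (∀ v → deg E v ≤ D) →
        let L = (3 + q) * k in
        2 * length E ≤ (2 + q) * L → j * ((L + D) + (L + D)) + k ≤ length E →
        EdgeLCP (suc j) k E
dense zero E q D k or deg≤D 2m≤ ≤m =
  const Fin.zero , λ { Fin.zero → ≤-trans ≤m (≤-reflexive (sym
    (count-total (mono? (const Fin.zero) Fin.zero) E λ _ → refl , refl))) }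
dense (suc j) E q D k or deg≤D 2m≤ ≤m
  -- The lower bound L ≤ 2m comes for free: m is at least one touched block 2(L + D).
  with S , S? , k≤e , touch≤T ← extract E q D k or deg≤D
         (≤-trans (≤-trans (m≤m+n _ D) (≤-trans (m≤m+n _ _)
           (≤-trans (m≤m+n _ _) (≤-trans (m≤m+n _ k) ≤m)))) (m≤m+n _ _)) 2m≤
  = ψ , λ { Fin.zero → ≤-trans k≤e (count-mono (both? S?) (mono? ψ Fin.zero) E λ _ (u∈S , v∈S) → ψ-in u∈S , ψ-in v∈S)
          ; (Fin.suc i) → ≤-trans (proj₂ IH i) (count-filter⁺ (mono? φ i) (¬? ∘ either? S?) (mono? ψ (Fin.suc i)) E
              λ _ (φu , φv) ¬uv → ψ-out (¬uv ∘ inj₁) φu , ψ-out (¬uv ∘ inj₂) φv) }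
  where
  L = (3 + q) * k
  T = (L + D) + (L + D)
  E′ = filter (¬? ∘ either? S?) E
  m≤ : length E ≤ T + length E′
  m≤ = ≤-trans (≤-reflexive (sym (count-total (λ _ → yes tt) E (λ _ → tt))))
    (≤-trans (count-split (λ _ → yes tt) (either? S?) (¬? ∘ either? S?) E λ {e} _ _ → toSum (either? S? e))
             (+-monoˡ-≤ _ touch≤T))
  IH : EdgeLCP (suc j) k E′
  IH = dense j E′ q D k (or ∘ proj₁ ∘ ∈-filter⁻ (¬? ∘ either? S?))
    (λ v → ≤-trans (deg-filter (¬? ∘ either? S?) E v) (deg≤D v))
    (≤-trans (*-monoʳ-≤ 2 (length-filter (¬? ∘ either? S?) E)) 2m≤)
    (+-cancelˡ-≤ T _ _ (≤-trans (≤-reflexive (sym (+-assoc T _ k))) (≤-trans ≤m m≤)))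
  φ = proj₁ IH
  ψ : ℕ → Fin (suc (suc j))
  ψ x with S? x
  ... | yes _ = Fin.zero
  ... | no  _ = Fin.suc (φ x)
  ψ-in : ∀ {x} → S x → ψ x ≡ Fin.zero
  ψ-in {x} x∈S with S? x
  ... | yes _   = refl
  ... | no  x∉S = contradiction x∈S x∉S
  ψ-out : ∀ {x i} → ¬ S x → φ x ≡ i → ψ x ≡ Fin.suc i
  ψ-out {x} x∉S φx with S? x
  ... | yes x∈S = contradiction x∈S x∉S
  ... | no  _   = cong Fin.suc φx

-- Deleting an edge at a vertex of high degree

length-concatMap : (f : Elt → List Elt′) (n : ℕ) (xs : List Elt) → (∀ x → length (f x) ≤ n) →
                   length (concatMap f xs) ≤ length xs * n
length-concatMap f n []       _  = z≤n
length-concatMap f n (x ∷ xs) f≤ =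
  ≤-trans (≤-reflexive (length-++ (f x))) (+-mono-≤ (f≤ x) (length-concatMap f n xs f≤))

ends⁺ : ∀ {E u v} → (u , v) ∈ E → u ∈ ends E × v ∈ ends E
ends⁺ (here refl) = here refl , there (here refl)
ends⁺ (there e∈)  = let u∈ , v∈ = ends⁺ e∈ in there (there u∈) , there (there v∈)

-- Keep only k edges of each class: they have at most 2ck endpoints. All other vertices take
-- the colour of w, which saves the class of w because w has k neighbours among them.
drop-edge : ∀ {c k E u v} w → w ≡ u ⊎ w ≡ v → Unique E → Oriented E → suc (2 * c) * k ≤ deg E w →
            EdgeLCP c k ((u , v) ∷ E) → EdgeLCP c k E
drop-edge {c} {k} {E} {u} {v} w w∈e !E or D≤deg (φ , k≤φ) = ψ , k≤ψ
  where
  i₀ = φ w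
  kept : Fin c → List Edge
  kept i = take k (filter (mono? φ i) E)
  U = ends (concatMap kept (allFin c))
  |U|≤ : length U ≤ 2 * c * k
  |U|≤ = begin
    length U                                      ≡⟨ length-ends (concatMap kept (allFin c)) ⟩
    2 * length (concatMap kept (allFin c))        ≤⟨ *-monoʳ-≤ 2 (length-concatMap kept k (allFin c) kept≤) ⟩
    2 * (length (allFin c) * k)                   ≡⟨ cong (λ n → 2 * (n * k)) (length-tabulate {n = c} id) ⟩
    2 * (c * k)                                   ≡⟨ *-assoc 2 c k ⟨
    2 * c * k                                     ∎
    where
    open ≤-Reasoning
    kept≤ : ∀ i → length (kept i) ≤ k
    kept≤ i = ≤-trans (≤-reflexive (length-take k (filter (mono? φ i) E))) (m⊓n≤m k _)
  ψ : ℕ → Fin c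
  ψ x with x ∈? U
  ... | yes _ = φ x
  ... | no  _ = i₀
  ψ-in : ∀ {x} → x ∈ U → ψ x ≡ φ x
  ψ-in {x} x∈U with x ∈? U
  ... | yes _   = refl
  ... | no  x∉U = contradiction x∈U x∉U
  ψ-out : ∀ {x} → ¬ x ∈ U → ψ x ≡ i₀
  ψ-out {x} x∉U with x ∈? U
  ... | yes x∈U = contradiction x∈U x∉U
  ... | no  _   = refl
  ψ-w : ψ w ≡ i₀
  ψ-w with w ∈? U
  ... | yes _ = refl
  ... | no  _ = refl
  kept-mono : ∀ {i e} → e ∈ kept i → ψ (proj₁ e) ≡ i × ψ (proj₂ e) ≡ i
  kept-mono {i} e∈ =
    let _ , φu≡i , φv≡i = ∈-filter⁻ (mono? φ i) {xs = E} (Sublist.lookup (take-⊆ k _) e∈)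
        u∈ , v∈         = ends⁺ (∈-concatMap⁺ kept {xs = allFin c} (Any.map (λ { refl → e∈ }) (∈-allFin i)))
    in trans (ψ-in u∈) φu≡i , trans (ψ-in v∈) φv≡i
  k≤ψ : ∀ i → k ≤ count (mono? ψ i) E
  k≤ψ i with i Fin.≟ i₀
  ... | no i≢i₀ = begin
    k                                       ≡⟨ m≤n⇒m⊓n≡m k≤class ⟨
    k ⊓ count (mono? φ i) E                 ≡⟨ length-take k (filter (mono? φ i) E) ⟨
    length (kept i)                         ≡⟨ count-total (mono? ψ i) (kept i) kept-mono ⟨
    count (mono? ψ i) (kept i)              ≤⟨ count-⊆ (mono? ψ i) (⊆-trans (take-⊆ k _) (filter-⊆ (mono? φ i) E)) ⟩
    count (mono? ψ i) E                     ∎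
    where
    open ≤-Reasoning
    -- The deleted edge contains `w`, so `i₀` is the only colour class it can belong to; every other
    -- class loses nothing.
    k≤class : k ≤ count (mono? φ i) E
    k≤class = ≤-trans (k≤φ i) (≤-reflexive (count-reject (mono? φ i) {xs = E} (e∉i w∈e)))
      where
      e∉i : w ≡ u ⊎ w ≡ v → ¬ (φ u ≡ i × φ v ≡ i)
      e∉i (inj₁ refl) (φu≡i , _) = i≢i₀ (sym φu≡i)
      e∉i (inj₂ refl) (_ , φv≡i) = i≢i₀ (sym φv≡i)
  -- Here the kept edges may be fewer than k, because the deleted edge may have been needed. The
  -- edges at `w` replace them: of k + 2ck edges, at most 2ck have their other end in `U`.
  ... | yes refl = +-cancelʳ-≤ (2 * c * k) k _ (begin
    k + 2 * c * k                                        ≤⟨ D≤deg ⟩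
    deg E w                                              ≡⟨ count-ends (_≟ w) E ⟩
    count ((_≟ w) ∘ proj₁) E + count ((_≟ w) ∘ proj₂) E  ≤⟨ oneEnd ⟩
    count at? E                                          ≤⟨ count-split at? (mono? ψ i₀) bad? E (λ _ → classify) ⟩
    count (mono? ψ i₀) E + count bad? E                  ≤⟨ +-monoʳ-≤ _ (≤-trans few |U|≤) ⟩
    count (mono? ψ i₀) E + 2 * c * k                     ∎)
    where
    open ≤-Reasoning
    at? : Decidable (λ ((a , b) : Edge) → a ≡ w ⊎ b ≡ w)
    at? (a , b) = (a ≟ w) ⊎-dec (b ≟ w)
    bad? : Decidable (λ ((a , b) : Edge) → (a ≡ w × b ∈ U) ⊎ (b ≡ w × a ∈ U))
    bad? (a , b) = ((a ≟ w) ×-dec (b ∈? U)) ⊎-dec ((b ≟ w) ×-dec (a ∈? U))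
    oneEnd : count ((_≟ w) ∘ proj₁) E + count ((_≟ w) ∘ proj₂) E ≤ count at? E
    oneEnd = count-disjoint at? ((_≟ w) ∘ proj₁) ((_≟ w) ∘ proj₂) E
      (λ _ → id) (λ { e∈ refl refl → <-irrefl refl (or e∈) })
    classify : ∀ {(a , b) : Edge} → a ≡ w ⊎ b ≡ w →
               (ψ a ≡ i₀ × ψ b ≡ i₀) ⊎ ((a ≡ w × b ∈ U) ⊎ (b ≡ w × a ∈ U))
    classify {a , b} (inj₁ refl) with toSum (b ∈? U)
    ... | inj₁ b∈U = inj₂ (inj₁ (refl , b∈U))
    ... | inj₂ b∉U = inj₁ (ψ-w , ψ-out b∉U)
    classify {a , b} (inj₂ refl) with toSum (a ∈? U)
    ... | inj₁ a∈U = inj₂ (inj₂ (refl , a∈U))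
    ... | inj₂ a∉U = inj₁ (ψ-out a∉U , ψ-w)
    edgeTo : ℕ → Edge
    edgeTo x = w ⊓ x , w ⊔ x
    -- Simplicity of the graph enters here: an edge at `w` is determined by its other end, the order
    -- of the pair being fixed by orientation.
    few : count bad? E ≤ length U
    few = ≤-trans (unique-length (Unique.filter⁺ bad? !E) bad⇒) (≤-reflexive (length-map edgeTo U))
      where
      bad⇒ : ∀ {e} → e ∈ filter bad? E → e ∈ map edgeTo U
      bad⇒ {a , b} e∈ with ∈-filter⁻ bad? {xs = E} e∈
      ... | e∈E , inj₁ (refl , b∈U) =
        subst (_∈ _) (cong₂ _,_ (m≤n⇒m⊓n≡m (<⇒≤ (or e∈E))) (m≤n⇒m⊔n≡n (<⇒≤ (or e∈E)))) (∈-map⁺ edgeTo b∈U)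
      ... | e∈E , inj₂ (refl , a∈U) =
        subst (_∈ _) (cong₂ _,_ (m≥n⇒m⊓n≡n (<⇒≤ (or e∈E))) (m≥n⇒m⊔n≡m (<⇒≤ (or e∈E)))) (∈-map⁺ edgeTo a∈U)

-- Greedy collection of kernel edges

Keep : ℕ → ℕ → List Edge → Pred Edge 0ℓ
Keep D M K (u , v) = deg K u < D × deg K v < D × length K < M

keep? : ∀ D M K → Decidable (Keep D M K)
keep? D M K (u , v) = (deg K u <? D) ×-dec (deg K v <? D) ×-dec (length K <? M)

-- A conditional on the Boolean `does` has the same form as the branch taken by the machine program.
tryAdd : ℕ → ℕ → Edge → List Edge → List Edge
tryAdd D M e K = if does (keep? D M K e) then e ∷ K else K

tryAdd-elim : (Q : List Edge → Set) → ∀ D M e K →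
           (Keep D M K e → Q (e ∷ K)) → (¬ Keep D M K e → Q K) → Q (tryAdd D M e K)
tryAdd-elim Q D M e K kept dropped = byDec (keep? D M K e)
  where
  byDec : (d : Dec (Keep D M K e)) → Q (if does d then e ∷ K else K)
  byDec (yes p) = kept p
  byDec (no ¬p) = dropped ¬p

greedy : ℕ → ℕ → List Edge → List Edge
greedy D M = foldr (tryAdd D M) []

module _ (D M : ℕ) where

  greedy-⊆ : ∀ E → greedy D M E ⊆ E
  greedy-⊆ []      = []
  greedy-⊆ (e ∷ E) = tryAdd-elim (_⊆ e ∷ E) D M e (greedy D M E)
    (λ _ → refl ∷ greedy-⊆ E) (λ _ → e ∷ʳ greedy-⊆ E)

  greedy-length : ∀ E → length (greedy D M E) ≤ M
  greedy-length []      = z≤n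
  greedy-length (e ∷ E) = tryAdd-elim (λ K → length K ≤ M) D M e (greedy D M E)
    (λ (_ , _ , <M) → <M) (λ _ → greedy-length E)

  -- As u < v, the vertex x is at most one of the two ends, so its degree grows by at most one, and
  -- only from a value below D.
  deg-∷ : ∀ u v E x → u < v → deg E u < D → deg E v < D → deg E x ≤ D → deg ((u , v) ∷ E) x ≤ D
  deg-∷ u v E x u<v u<D v<D ≤D with u ≟ x | v ≟ x
  ... | yes refl | yes refl = contradiction u<v (<-irrefl refl)
  ... | yes refl | no  v≢x  = ≤-trans (≤-reflexive (trans (count-accept (_≟ x) {xs = v ∷ ends E} refl)
                                       (cong suc (count-reject (_≟ x) {xs = ends E} v≢x)))) u<D
  ... | no  u≢x  | yes refl = ≤-trans (≤-reflexive (trans (count-reject (_≟ x) {xs = v ∷ ends E} u≢x)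
                                       (count-accept (_≟ x) {xs = ends E} refl))) v<D
  ... | no  u≢x  | no  v≢x  = ≤-trans (≤-reflexive (trans (count-reject (_≟ x) {xs = v ∷ ends E} u≢x)
                                       (count-reject (_≟ x) {xs = ends E} v≢x))) ≤D

  greedy-deg : ∀ E → Oriented E → ∀ x → deg (greedy D M E) x ≤ D
  greedy-deg []            _  _ = z≤n
  greedy-deg ((u , v) ∷ E) or x = tryAdd-elim (λ K → deg K x ≤ D) D M (u , v) (greedy D M E)
    (λ (u<D , v<D , _) → deg-∷ u v (greedy D M E) x (or (here refl)) u<D v<D (greedy-deg E (or ∘ there) x))
    (λ _ → greedy-deg E (or ∘ there) x)

  deg-++ʳ : ∀ E F x → deg F x ≤ deg (E ++ F) x
  deg-++ʳ E F x = ≤-trans (m≤n+m _ (deg E x)) (≤-reflexive (sym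
    (trans (cong (count (_≟ x)) (concatMap-++ (λ (u , v) → u ∷ v ∷ []) E F)) (count-++ (_≟ x) (ends E) (ends F)))))

  -- `greedy` works from the end of the list, and `F` is the part it has not reached. The induction
  -- hypothesis, with `e` moved into `F`, first removes all edges rejected before `e`; only then is
  -- `e` itself deleted. Since the collection stays shorter than M, a rejection can only be due to a
  -- degree.
  greedy-complete : ∀ {c k} F E → Unique (F ++ E) → Oriented (F ++ E) → suc (2 * c) * k ≤ D →
                    length (greedy D M E) < M → EdgeLCP c k (F ++ E) → EdgeLCP c k (F ++ greedy D M E)
  greedy-complete F []      _ _  _   _  lcp = lcp
  greedy-complete {c} {k} F (e@(u , v) ∷ E) !FE or D≥
    = tryAdd-elim (λ K → length K < M → EdgeLCP c k (F ++ e ∷ E) → EdgeLCP c k (F ++ K)) D M e K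
        (λ _ <M → IH (≤-trans (n≤1+n _) <M))
        (λ ¬keep <M lcp → byDegree ¬keep (deg K u <? D) (deg K v <? D) <M (edgeLCP-↭ (shift e F K) (IH <M lcp)))
    where
    K = greedy D M E
    ++-∷ : ∀ G → (F ++ e ∷ []) ++ G ≡ F ++ e ∷ G
    ++-∷ = ++-assoc F (e ∷ [])
    IH : length K < M → EdgeLCP c k (F ++ e ∷ E) → EdgeLCP c k (F ++ e ∷ K)
    IH <M lcp = subst (EdgeLCP c k) (++-∷ K)
      (greedy-complete (F ++ e ∷ []) E (subst Unique (sym (++-∷ E)) !FE)
        (or ∘ subst (_ ∈_) (++-∷ E)) D≥ <M (subst (EdgeLCP c k) (sym (++-∷ E)) lcp))
    F++K⊆ : F ++ K ⊆ F ++ e ∷ E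
    F++K⊆ = ++⁺ ⊆-refl (e ∷ʳ greedy-⊆ E)
    drop : ∀ w → w ≡ u ⊎ w ≡ v → ¬ deg K w < D → EdgeLCP c k (e ∷ F ++ K) → EdgeLCP c k (F ++ K)
    -- The degree D is already reached among the collected edges `K`; the edges of `F` can only
    -- raise it.
    drop w w∈e ≮D = drop-edge w w∈e (unique-⊆ F++K⊆ !FE) (or ∘ Sublist.lookup F++K⊆)
      (≤-trans D≥ (≤-trans (≮⇒≥ ≮D) (deg-++ʳ F K w)))
    byDegree : ¬ Keep D M K e → Dec (deg K u < D) → Dec (deg K v < D) → length K < M →
               EdgeLCP c k (e ∷ F ++ K) → EdgeLCP c k (F ++ K)
    byDegree _     (no u≮D)  _         _  = drop u (inj₁ refl) u≮D
    byDegree _     (yes _)   (no v≮D)  _  = drop v (inj₂ refl) v≮D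
    byDegree ¬keep (yes u<D) (yes v<D) <M = contradiction (u<D , v<D , <M) ¬keep

-- With D = degreeCap c · k and the choice L = 6ck in dense, edgeCap c · k = (c - 1) · 2(L + D) + k.
degreeCap edgeCap : ℕ → ℕ
degreeCap c = suc (2 * c)
edgeCap c = pred c * (16 * c + 2) + 1

sparsify : ℕ → ℕ → List Edge → List Edge
sparsify c k = greedy (degreeCap c * k) (edgeCap c * k)

sparsify-LCP : ∀ c .{{_ : NonZero c}} k E → Unique E → Oriented E →
               EdgeLCP c k E ⇔ EdgeLCP c k (sparsify c k E)
sparsify-LCP c@(suc j) k E !E or = mk⇔ to (edgeLCP-⊆ (greedy-⊆ D M E))
  where
  D = degreeCap c * k
  M = edgeCap c * k
  K = sparsify c k E
  -- This makes 3 + q = 6c, hence L = 6ck. In `sparse`, the term in front of the equality sign with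
  -- 4j² is the slack between 2M and (2 + q)L; `large` holds with equality by the choice of
  -- `edgeCap`.
  q = 3 + 6 * j
  to : EdgeLCP c k E → EdgeLCP c k K
  to lcp with length K <? M
  ... | yes <M = greedy-complete D M [] E !E or ≤-refl <M lcp
  ... | no  ≮M = dense j K q D k (or ∘ Sublist.lookup (greedy-⊆ D M E)) (greedy-deg D M E or)
      (≤-trans (*-monoʳ-≤ 2 (greedy-length D M E)) (≤-trans (m≤m+n _ _) (≤-reflexive (sparse j k))))
      (≤-trans (≤-reflexive (large j k)) (≮⇒≥ ≮M))
    where
    sparse : ∀ j k → 2 * ((j * (16 * suc j + 2) + 1) * k) + (4 * (j * j) + 30 * j + 28) * k
             ≡ (2 + (3 + 6 * j)) * ((3 + (3 + 6 * j)) * k)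
    sparse = solve-∀
    large : ∀ j k → let touched = (3 + (3 + 6 * j)) * k + suc (2 * suc j) * k in
            j * (touched + touched) + k
            ≡ (j * (16 * suc j + 2) + 1) * k
    large = solve-∀

-- Graphs as labelled edge lists

relabel : ∀ {n} → (Fin n → ℕ) → Fin n × Fin n → Edge
relabel lab (u , v) = lab u , lab v

-- The input and the kernel have different vertex types; labelling both by natural numbers makes
-- their colourings comparable. Injectivity allows a colour to be read back from a label.
labelled-LCP : ∀ {c} .{{_ : NonZero c}} k G {lab : Fin (order G) → ℕ} {E} → Injective _≡_ _≡_ lab →
               map (relabel lab) (edges G) ↭ E → LCP c k G ⇔ EdgeLCP c k E
labelled-LCP {c@(suc _)} k G {lab} {E} inj ↭E = mk⇔ to from
  where
  toLoad : ∀ (φ : ℕ → Fin c) i → load G (φ ∘ lab) i ≡ count (mono? φ i) E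
  toLoad φ i = trans (sym (count-map (mono? φ i) (relabel lab) (edges G))) (count-↭ (mono? φ i) ↭E)
  from : EdgeLCP c k E → LCP c k G
  from (φ , k≤) = φ ∘ lab , λ i → ≤-trans (k≤ i) (≤-reflexive (sym (toLoad φ i)))
  to : LCP c k G → EdgeLCP c k E
  to (φ , k≤) = ψ , λ i → ≤-trans (k≤ i) (≤-trans
      (count-mono (λ (u , v) → (φ u Fin.≟ i) ×-dec (φ v Fin.≟ i)) (mono? ψ i ∘ relabel lab) (edges G)
        λ _ (φu , φv) → trans (ψ-lab _) φu , trans (ψ-lab _) φv)
      (≤-reflexive (toLoad ψ i)))
    where
    ψ : ℕ → Fin c
    ψ x with Fin.any? (λ i → lab i ≟ x)
    ... | yes (i , _) = φ i
    -- Default colour for numbers that label no vertex; a colour exists because c is positive.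
    ... | no  _       = Fin.zero
    ψ-lab : ∀ u → ψ (lab u) ≡ φ u
    ψ-lab u with Fin.any? (λ i → lab i ≟ lab u)
    ... | yes (i , eq) = cong φ (inj eq)
    ... | no  ∄        = contradiction (u , refl) ∄

isEdge? : ∀ G → Decidable (λ ((u , v) : Fin (order G) × Fin (order G)) → u Fin.< v × adj G u v ≡ true)
isEdge? G (u , v) = (u Fin.<? v) ×-dec (adj G u v Bool.≟ true)

unique-edges : ∀ G → Unique (edges G)
unique-edges G = Unique.filter⁺ (isEdge? G) (Unique.cartesianProduct⁺ (Unique.allFin⁺ _) (Unique.allFin⁺ _))

∈-edges⁺ : ∀ G {u v} → u Fin.< v → adj G u v ≡ true → (u , v) ∈ edges G
∈-edges⁺ G u<v uv = ∈-filter⁺ (isEdge? G) (∈-cartesianProduct⁺ (∈-allFin _) (∈-allFin _)) (u<v , uv)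

∈-edges⁻ : ∀ G {u v} → (u , v) ∈ edges G → u Fin.< v × adj G u v ≡ true
∈-edges⁻ G uv∈ = proj₂ (∈-filter⁻ (isEdge? G) {xs = cartesianProduct (allFin (order G)) (allFin (order G))} uv∈)

edgeList : Graph → List Edge
edgeList G = map (relabel toℕ) (edges G)

relabel-injective : ∀ {n} {lab : Fin n → ℕ} → Injective _≡_ _≡_ lab → Injective _≡_ _≡_ (relabel lab)
relabel-injective inj eq = cong₂ _,_ (inj (cong proj₁ eq)) (inj (cong proj₂ eq))

edgeList-unique : ∀ G → Unique (edgeList G)
edgeList-unique G = Unique.map⁺ (relabel-injective Fin.toℕ-injective) (unique-edges G)

∈-edgeList : ∀ G {u v} → (u , v) ∈ edgeList G → u < v × v < order G
∈-edgeList G e∈ with (i , j) , ij∈ , refl ← ∈-map⁻ (relabel toℕ) e∈ =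
  proj₁ (∈-edges⁻ G ij∈) , Fin.toℕ<n j

-- The graph formed by the kernel edges

Joins : ℕ → ℕ → Pred Edge 0ℓ
Joins u v (a , b) = (a ≡ u × b ≡ v) ⊎ (a ≡ v × b ≡ u)

joins? : ∀ u v → Decidable (Joins u v)
joins? u v (a , b) = ((a ≟ u) ×-dec (b ≟ v)) ⊎-dec ((a ≟ v) ×-dec (b ≟ u))

joined? : ∀ K u v → Dec (Any (Joins u v) K)
joined? K u v = any? (joins? u v) K

-- The list is ascending, so positions in it compare as the vertices themselves do.
nonIsolated : List Edge → ℕ → List ℕ
nonIsolated K n = filter (λ v → 0 <? deg K v) (map toℕ (allFin n))

joins-sym : ∀ {K u v} → Any (Joins u v) K → Any (Joins v u) K
joins-sym = Any.map Sum.swap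

joined⁻ : ∀ {K u v} → Any (Joins u v) K → (u , v) ∈ K ⊎ (v , u) ∈ K
joined⁻ (here (inj₁ (refl , refl))) = inj₁ (here refl)
joined⁻ (here (inj₂ (refl , refl))) = inj₂ (here refl)
joined⁻ (there p) = Sum.map there there (joined⁻ p)

does-sym : ∀ K u v → does (joined? K u v) ≡ does (joined? K v u)
does-sym K u v with joined? K u v
... | yes p = sym (dec-true (joined? K v u) (joins-sym p))
... | no ¬p = sym (dec-false (joined? K v u) (¬p ∘ joins-sym))

does⁻ : {P : Set} (P? : Dec P) → does P? ≡ true → P
does⁻ (yes p) _ = p

inducedGraph : ∀ K → Oriented K → List ℕ → Graph
inducedGraph K or vs = record
  { order   = length vs
  ; adj     = λ i j → does (joined? K (lookup vs i) (lookup vs j))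
  ; adj-sym = λ i j → does-sym K (lookup vs i) (lookup vs j)
  ; no-loop = λ i → dec-false (joined? K (lookup vs i) (lookup vs i))
                      (Sum.[ <-irrefl refl ∘ or , <-irrefl refl ∘ or ] ∘ joined⁻)
  }

lookup-< : ∀ {vs} → AllPairs _<_ vs → ∀ {i j} → i Fin.< j → lookup vs i < lookup vs j
lookup-< (x< ∷ _)  {Fin.zero}  {Fin.suc j} _   = All.lookup x< (∈-lookup j)
lookup-< (_ ∷ vs<) {Fin.suc i} {Fin.suc j} i<j = lookup-< vs< (s<s⁻¹ i<j)

lookup-reflects-< : ∀ {vs} → AllPairs _<_ vs → ∀ {i j} → lookup vs i < lookup vs j → i Fin.< j
lookup-reflects-< vs< {i} {j} lt with Fin.<-cmp i j
... | tri< i<j _ _ = i<j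
... | tri≈ _ refl _ = contradiction lt (<-irrefl refl)
... | tri> _ _ j<i = contradiction lt (<-asym (lookup-< vs< j<i))

lookup-injective : ∀ {vs} → AllPairs _<_ vs → Injective _≡_ _≡_ (lookup vs)
lookup-injective vs< {i} {j} eq with Fin.<-cmp i j
... | tri< i<j _ _ = contradiction eq (<⇒≢ (lookup-< vs< i<j))
... | tri≈ _ i≡j _ = i≡j
... | tri> _ _ j<i = contradiction (sym eq) (<⇒≢ (lookup-< vs< j<i))

∈⇒deg>0 : ∀ {E x} → x ∈ ends E → 0 < deg E x
∈⇒deg>0 {E} {x} x∈ = nonEmpty (∈-filter⁺ (_≟ x) x∈ refl)
  where
  nonEmpty : ∀ {y : ℕ} {ys} → y ∈ ys → 0 < length ys
  nonEmpty (here _)  = s≤s z≤n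
  nonEmpty (there _) = s≤s z≤n

deg>0⇒∈ : ∀ {E x} → 0 < deg E x → x ∈ ends E
deg>0⇒∈ {E} {x} 0< = inhabited (filter (_≟ x) (ends E)) 0< (∈-filter⁻ (_≟ x) {xs = ends E})
  where
  inhabited : ∀ ys → 0 < length ys → (∀ {y} → y ∈ ys → y ∈ ends E × y ≡ x) → x ∈ ends E
  inhabited (y ∷ _) _ f = let y∈ , y≡x = f (here refl) in subst (_∈ ends E) y≡x y∈

module _ (K : List Edge) (n : ℕ) (!K : Unique K) (or : Oriented K) (K<n : ∀ {u v} → (u , v) ∈ K → v < n) where

  private
    vs = nonIsolated K n
    H = inducedGraph K or vs

  vs-sorted : AllPairs _<_ vs
  vs-sorted = AllPairs.filter⁺ (λ v → 0 <? deg K v)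
    (AllPairs.map⁺ {f = toℕ} (AllPairs.tabulate⁺-< {f = id {A = Fin n}} id))

  ∈-vs⁺ : ∀ {x} → x < n → x ∈ ends K → x ∈ vs
  ∈-vs⁺ x<n x∈ = ∈-filter⁺ (λ v → 0 <? deg K v)
    (subst (_∈ map toℕ (allFin n)) (Fin.toℕ-fromℕ< x<n) (∈-map⁺ toℕ (∈-allFin (Fin.fromℕ< x<n))))
    (∈⇒deg>0 {K} x∈)

  -- Both lists are free of duplicates, so equal membership suffices. Because `vs` is ascending, the
  -- orientation by position agrees with the orientation in `K`, and no pair appears reversed.
  inducedGraph-edges : map (relabel (lookup vs)) (edges H) ↭ K
  inducedGraph-edges = ∼bag⇒↭ (unique∧set⇒bag
      (Unique.map⁺ (relabel-injective (lookup-injective vs-sorted)) (unique-edges H)) !K (mk⇔ to from))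
    where
    to : ∀ {e} → e ∈ map (relabel (lookup vs)) (edges H) → e ∈ K
    to e∈ with (i , j) , ij∈ , refl ← ∈-map⁻ (relabel (lookup vs)) e∈
          with i<j , ij ← ∈-edges⁻ H ij∈
          with joined⁻ (does⁻ (joined? K (lookup vs i) (lookup vs j)) ij)
    ... | inj₁ ij∈K = ij∈K
    ... | inj₂ ji∈K = contradiction (or ji∈K) (<-asym (lookup-< vs-sorted i<j))
    from : ∀ {e} → e ∈ K → e ∈ map (relabel (lookup vs)) (edges H)
    from {u , v} e∈ = subst (_∈ _) (sym (cong₂ _,_ u≡ v≡))
      (∈-map⁺ (relabel (lookup vs)) (∈-edges⁺ H
        (lookup-reflects-< vs-sorted (subst₂ _<_ u≡ v≡ (or e∈)))
        (dec-true (joined? K _ _) (Any.map (λ { refl → inj₁ (u≡ , v≡) }) e∈))))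
      where
      u∈ = ∈-vs⁺ (<-trans (or e∈) (K<n e∈)) (proj₁ (ends⁺ e∈))
      v∈ = ∈-vs⁺ (K<n e∈) (proj₂ (ends⁺ e∈))
      u≡ : u ≡ lookup vs (Any.index u∈)
      u≡ = lookup-index u∈
      v≡ : v ≡ lookup vs (Any.index v∈)
      v≡ = lookup-index v∈

  inducedGraph-∣E∣ : ∣E∣ H ≡ length K
  inducedGraph-∣E∣ = trans (sym (length-map (relabel (lookup vs)) (edges H))) (↭-length inducedGraph-edges)

  inducedGraph-LCP : ∀ {c} .{{_ : NonZero c}} k → LCP c k H ⇔ EdgeLCP c k K
  inducedGraph-LCP k = labelled-LCP k H (lookup-injective vs-sorted) inducedGraph-edges

  -- Every remaining vertex has positive degree and so occurs among the 2|K| edge ends.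
  inducedGraph-order : order H ≤ 2 * length K
  inducedGraph-order = ≤-trans
    (unique-length (Unique.filter⁺ (λ v → 0 <? deg K v) (Unique.map⁺ Fin.toℕ-injective (Unique.allFin⁺ n)))
      λ x∈ → deg>0⇒∈ {K} (proj₂ (∈-filter⁻ (λ v → 0 <? deg K v) {xs = map toℕ (allFin n)} x∈)))
    (≤-reflexive (length-ends K))

-- The reduction and its bounds

module _ (c : ℕ) .{{_ : NonZero c}} (I : Instance) where

  private
    G = graph I
    k = param I
    E = edgeList G

  kernelEdges : List Edge
  kernelEdges = sparsify c k E

  kernel-⊆ : kernelEdges ⊆ E
  kernel-⊆ = greedy-⊆ (degreeCap c * k) (edgeCap c * k) E

  kernel-oriented : Oriented kernelEdges
  kernel-oriented = proj₁ ∘ ∈-edgeList G ∘ Sublist.lookup kernel-⊆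

  reduceInstance : Instance
  reduceInstance = record
    { graph = inducedGraph kernelEdges kernel-oriented (nonIsolated kernelEdges (order G))
    ; param = k
    ; 1≤k   = 1≤k I
    }

  private
    !K = unique-⊆ kernel-⊆ (edgeList-unique G)
    K<n : ∀ {u v} → (u , v) ∈ kernelEdges → v < order G
    K<n = proj₂ ∘ ∈-edgeList G ∘ Sublist.lookup kernel-⊆

  reduce-equivalent : I ∈LCP c ⇔ reduceInstance ∈LCP c
  reduce-equivalent =
    Composition.equivalence (labelled-LCP k G Fin.toℕ-injective ↭-refl)
      (Composition.equivalence (sparsify-LCP c k E (edgeList-unique G) (proj₁ ∘ ∈-edgeList G))
        (Symmetry.equivalence (inducedGraph-LCP kernelEdges (order G) !K kernel-oriented K<n k)))

  reduce-edges : ∣E∣ (graph reduceInstance) ≤ edgeCap c * k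
  reduce-edges = ≤-trans
    (≤-reflexive (inducedGraph-∣E∣ kernelEdges (order G) !K kernel-oriented K<n))
    (greedy-length (degreeCap c * k) (edgeCap c * k) E)

  reduce-order : order (graph reduceInstance) ≤ 2 * (edgeCap c * k)
  reduce-order = ≤-trans
    (inducedGraph-order kernelEdges (order G) !K kernel-oriented K<n)
    (*-monoʳ-≤ 2 (greedy-length (degreeCap c * k) (edgeCap c * k) E))

-- With j = c - 1 the polynomial 16c² - 6c becomes 16j² + 26j + 10, which is free of subtraction.
f-polynomial : ∀ j k → f (2 * suc j) k (2 * suc j * k) ≡ (16 * (j * j) + 26 * j + 10) * k
f-polynomial = lemma
  where
  -- The left-hand side is f with its truncated subtractions evaluated.
  lemma : ∀ j k → (j + suc (j + 0) + suc (j + suc (j + 0) + 0)) * (2 * suc j) * k +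
                  2 * (2 * suc j * k) * (j + suc (j + 0))
          ≡ (16 * (j * j) + 26 * j + 10) * k
  lemma = solve-∀

f-formula : ∀ c .{{_ : NonZero c}} k → f (2 * c) k (2 * c * k) ≡ 16 * c ^ 2 * k ∸ 6 * c * k
f-formula (suc j) k = trans (f-polynomial j k)
  (sym (trans (cong (_∸ 6 * suc j * k) (lemma j k)) (m+n∸n≡m _ (6 * suc j * k))))
  where
  lemma : ∀ j k → 16 * (suc j * (suc j * 1)) * k ≡ (16 * (j * j) + 26 * j + 10) * k + 6 * suc j * k
  lemma = solve-∀

-- The gap is (8c + 1)k, written (9 + 8j)k; it is positive because k ≥ 1.
edgeCap<f : ∀ c .{{_ : NonZero c}} k → 1 ≤ k → edgeCap c * k < f (2 * c) k (2 * c * k)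
edgeCap<f (suc j) k@(suc _) _ = <-≤-trans (m<m+n _ {(9 + 8 * j) * k} (s≤s z≤n))
  (≤-reflexive (trans (lemma j k) (sym (f-polynomial j k))))
  where
  lemma : ∀ j k → (j * (16 * suc j + 2) + 1) * k + (9 + 8 * j) * k ≡ (16 * (j * j) + 26 * j + 10) * k
  lemma = solve-∀

-- Polynomial-time programs

infixl 6 _⊞_
infixl 7 _⊠_

-- Polynomials are kept as syntax with natural coefficients: they are closed under substitution,
-- which composing programs requires, and are automatically monotone.
data Poly : Set where
  κ       : ℕ → Poly
  X       : Poly
  _⊞_ _⊠_ : Poly → Poly → Poly

eval : Poly → ℕ → ℕ
eval (κ n)   s = n
eval X       s = s
eval (P ⊞ Q) s = eval P s + eval Q s
eval (P ⊠ Q) s = eval P s * eval Q s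

_⟪_⟫ : Poly → Poly → Poly
κ n     ⟪ R ⟫ = κ n
X       ⟪ R ⟫ = R
(P ⊞ Q) ⟪ R ⟫ = P ⟪ R ⟫ ⊞ Q ⟪ R ⟫
(P ⊠ Q) ⟪ R ⟫ = P ⟪ R ⟫ ⊠ Q ⟪ R ⟫

eval-⟪⟫ : ∀ P R s → eval (P ⟪ R ⟫) s ≡ eval P (eval R s)
eval-⟪⟫ (κ n)   R s = refl
eval-⟪⟫ X       R s = refl
eval-⟪⟫ (P ⊞ Q) R s = cong₂ _+_ (eval-⟪⟫ P R s) (eval-⟪⟫ Q R s)
eval-⟪⟫ (P ⊠ Q) R s = cong₂ _*_ (eval-⟪⟫ P R s) (eval-⟪⟫ Q R s)

eval-mono : ∀ P {m n} → m ≤ n → eval P m ≤ eval P n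
eval-mono (κ _)   m≤n = ≤-refl
eval-mono X       m≤n = m≤n
eval-mono (P ⊞ Q) m≤n = +-mono-≤ (eval-mono P m≤n) (eval-mono Q m≤n)
eval-mono (P ⊠ Q) m≤n = *-mono-≤ (eval-mono P m≤n) (eval-mono Q m≤n)

-- Exponents are added even for a sum. For s ≥ 1 raising the exponent only increases the power, so
-- no maximum has to be taken.
monomial-bound : ∀ P → ∃₂ λ a d → ∀ s .{{_ : NonZero s}} → eval P s ≤ a * s ^ d
monomial-bound (κ n)   = n , 0 , λ s → ≤-reflexive (sym (*-identityʳ n))
monomial-bound X       = 1 , 1 , λ s → ≤-reflexive (sym (trans (*-identityˡ (s * 1)) (*-identityʳ s)))
monomial-bound (P ⊞ Q) with a , d , P≤ ← monomial-bound P | b , e , Q≤ ← monomial-bound Q =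
  a + b , d + e , λ s → ≤-trans
    (+-mono-≤ (≤-trans (P≤ s) (*-monoʳ-≤ a (^-monoʳ-≤ s (m≤m+n d e))))
              (≤-trans (Q≤ s) (*-monoʳ-≤ b (^-monoʳ-≤ s (m≤n+m e d)))))
    (≤-reflexive (sym (*-distribʳ-+ (s ^ (d + e)) a b)))
monomial-bound (P ⊠ Q) with a , d , P≤ ← monomial-bound P | b , e , Q≤ ← monomial-bound Q =
  a * b , d + e , λ s → ≤-trans (*-mono-≤ (P≤ s) (Q≤ s)) (≤-reflexive (trans
    (*-interchange a (s ^ d) b (s ^ e)) (cong (a * b *_) (sym (^-distribˡ-+-* s d e)))))
  where
  *-interchange : ∀ a x b y → (a * x) * (b * y) ≡ (a * b) * (x * y)
  *-interchange = solve-∀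

-- Sizes of data and of primitive results

lsize : ∀ A → List ⟦ A ⟧ → ℕ
lsize A xs = sum (map (λ x → suc (size A x)) xs)

size≥1 : ∀ A x → 1 ≤ size A x
size≥1 unit     _        = s≤s z≤n
size≥1 nat      _        = s≤s z≤n
size≥1 (A ⊕ B)  (inj₁ _) = s≤s z≤n
size≥1 (A ⊕ B)  (inj₂ _) = s≤s z≤n
size≥1 (A ⊗ B)  _        = s≤s z≤n
size≥1 (list A) _        = s≤s z≤n

lsize-ʳ++ : ∀ A xs ys → lsize A (xs ʳ++ ys) ≡ lsize A xs + lsize A ys
lsize-ʳ++ A []       ys = refl
lsize-ʳ++ A (x ∷ xs) ys = trans (lsize-ʳ++ A xs (x ∷ ys)) (shuffle (lsize A xs) (suc (size A x)) (lsize A ys))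
  where
  shuffle : ∀ a b c → a + (b + c) ≡ (b + a) + c
  shuffle = solve-∀

lsize-++ : ∀ A xs ys → lsize A (xs ++ ys) ≡ lsize A xs + lsize A ys
lsize-++ A []       ys = refl
lsize-++ A (x ∷ xs) ys = trans (cong (suc (size A x) +_) (lsize-++ A xs ys)) (sym (+-assoc (suc (size A x)) _ _))

length≤lsize : ∀ A xs → length xs ≤ lsize A xs
length≤lsize A []       = z≤n
length≤lsize A (x ∷ xs) = s≤s (≤-trans (length≤lsize A xs) (m≤n+m _ (size A x)))

n<2^n : ∀ n → n < 2 ^ n
n<2^n zero    = s≤s z≤n
n<2^n (suc n) = +-mono-≤ (m^n>0 2 n) (≤-trans (n<2^n n) (≤-reflexive (sym (+-identityʳ _))))

⌊log₂n⌋≤n : ∀ n → ⌊log₂ n ⌋ ≤ n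
⌊log₂n⌋≤n n = ≤-trans (⌊log₂⌋-mono-≤ (<⇒≤ (n<2^n n))) (≤-reflexive (⌊log₂[2^n]⌋≡n n))

⌊log₂2n⌋ : ∀ n → ⌊log₂ (2 * n) ⌋ ≤ suc ⌊log₂ n ⌋
⌊log₂2n⌋ zero      = z≤n
⌊log₂2n⌋ n@(suc _) = ≤-reflexive (⌊log₂[2*b]⌋≡1+⌊log₂b⌋ n)

-- The sum is at most twice the larger summand, and doubling adds one bit.
⌊log₂⌋-+ : ∀ m n → ⌊log₂ (m + n) ⌋ ≤ suc (⌊log₂ m ⌋ + ⌊log₂ n ⌋)
⌊log₂⌋-+ m n with ≤-total m n
... | inj₁ m≤n = ≤-trans (⌊log₂⌋-mono-≤ (+-mono-≤ m≤n (≤-reflexive (sym (+-identityʳ n)))))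
                         (≤-trans (⌊log₂2n⌋ n) (s≤s (m≤n+m _ ⌊log₂ m ⌋)))
... | inj₂ n≤m = ≤-trans (⌊log₂⌋-mono-≤ (+-monoʳ-≤ m (≤-trans n≤m (≤-reflexive (sym (+-identityʳ m))))))
                         (≤-trans (⌊log₂2n⌋ m) (s≤s (m≤m+n _ _)))

primConst : ∀ {A B} → Prim A B → ℕ
primConst (lit n) = suc n
primConst _       = 2

-- Every primitive enlarges its data by at most an additive constant. For `add` this rests on the
-- bit-length bound for sums, for `lit` the constant depends on the literal.
size-run : ∀ {A B} (p : Prim A B) x → size B (run p x) ≤ size A x + primConst p
size-run         idₚ     x             = m≤m+n _ 2
size-run         fst     (x , y)       = ≤-trans (m≤n⇒m≤1+n (m≤m+n _ _)) (m≤m+n _ 2)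
size-run         snd     (x , y)       = ≤-trans (m≤n⇒m≤1+n (m≤n+m _ _)) (m≤m+n _ 2)
size-run {A}     unitₚ   x             = ≤-trans (size≥1 A x) (m≤m+n _ 2)
size-run {A}     inl     x             = ≤-trans (≤-reflexive (+-comm 1 (size A x))) (+-monoʳ-≤ _ (s≤s z≤n))
size-run {A}     inr     x             = ≤-trans (≤-reflexive (+-comm 1 (size A x))) (+-monoʳ-≤ _ (s≤s z≤n))
size-run {A}     nil     x             = ≤-trans (size≥1 A x) (m≤m+n _ 2)
size-run {A ⊗ _} cons    (x , xs)      = ≤-trans (≤-reflexive (cong suc (sym (+-suc (size A x) _)))) (m≤m+n _ 2)
size-run         uncons  []            = ≤-trans (n≤1+n 2) ≤-refl
size-run {list A} uncons (x ∷ xs)      = ≤-trans (≤-reflexive (shuffle (size A x) (lsize A xs)))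
  (+-monoʳ-≤ (suc (suc (size A x) + lsize A xs)) (s≤s z≤n))
  where
  shuffle : ∀ a b → suc (suc (a + suc b)) ≡ suc (suc a + b) + 1
  shuffle = solve-∀
size-run {A}     (lit n) x             = ≤-trans (s≤s (⌊log₂n⌋≤n n)) (m≤n+m _ (size A x))
size-run         add     (m , n)       = ≤-trans (s≤s (⌊log₂⌋-+ m n))
  (≤-trans (≤-reflexive (sym (cong suc (+-suc _ _)))) (≤-trans (s≤s (n≤1+n _)) (m≤m+n _ 2)))
size-run         monus   (m , n)       = ≤-trans (s≤s (⌊log₂⌋-mono-≤ (m∸n≤m m n)))
  (≤-trans (m≤n⇒m≤1+n (m≤m+n _ _)) (m≤m+n _ 2))
size-run         half    n             = ≤-trans (s≤s (⌊log₂⌋-mono-≤ (⌊n/2⌋≤n n))) (m≤m+n _ 2)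
size-run         isZero  zero          = s≤s (s≤s z≤n)
size-run         isZero  (suc n)       = s≤s (≤-trans (s≤s z≤n) (m≤n+m 2 _))

-- Writing is charged for. A time bound is therefore also a bound on the input size of the next
-- program, and time bounds compose by substitution.
output≤time : ∀ {A B} {p : Prog A B} {x y t} → p ⊢ x ⇓ y [ t ] → size B y ≤ t
output≤time ⇓prim          = m≤n⇒m≤1+n (m≤n+m _ _)
output≤time (⇓seq _ d)     = m≤n⇒m≤1+n (≤-trans (output≤time d) (m≤n+m _ _))
output≤time (⇓pair {x = x} d e) = s≤s (≤-trans (+-mono-≤ (output≤time d) (output≤time e)) (m≤n+m _ (size _ x)))
output≤time (⇓inj₁ d)      = m≤n⇒m≤1+n (≤-trans (output≤time d) (m≤n+m _ _))
output≤time (⇓inj₂ d)      = m≤n⇒m≤1+n (≤-trans (output≤time d) (m≤n+m _ _))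
output≤time (⇓more _ d)    = m≤n⇒m≤1+n (≤-trans (output≤time d) (m≤n+m _ _))
output≤time (⇓done d)      = ≤-trans (≤-trans (n≤1+n _) (output≤time d)) (n≤1+n _)

-- Functions computed in polynomial time

record PT (A B : Ty) (fn : ⟦ A ⟧ → ⟦ B ⟧) : Set where
  field
    prog  : Prog A B
    bound : Poly
    halts : ∀ x → ∃[ t ] (prog ⊢ x ⇓ fn x [ t ] × t ≤ eval bound (size A x))

  size-output : ∀ x → size B (fn x) ≤ eval bound (size A x)
  size-output x = let _ , d , t≤ = halts x in ≤-trans (output≤time d) t≤

open PT

private variable
  A B C Γ : Ty

opaque

  ext : ∀ {f g} → PT A B f → f ≗ g → PT A B g
  ext p f≗g .prog    = prog p
  ext p f≗g .bound   = bound p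
  ext p f≗g .halts x with t , d , t≤ ← halts p x = t , subst (λ y → prog p ⊢ x ⇓ y [ t ]) (f≗g x) d , t≤

opaque

  basic : (p : Prim A B) → PT A B (run p)
  basic p .prog    = prim p
  basic p .bound   = κ 1 ⊞ X ⊞ (X ⊞ κ (primConst p))
  basic p .halts x = _ , ⇓prim , s≤s (+-monoʳ-≤ _ (size-run p x))

opaque

  infixr 9 _⊚_
  _⊚_ : ∀ {f g} → PT B C g → PT A B f → PT A C (g ∘ f)
  (q ⊚ p) .prog    = prog p ⨾ prog q
  (q ⊚ p) .bound   = κ 1 ⊞ (bound p ⊞ bound q ⟪ bound p ⟫)
  _⊚_ {f = f} q p .halts x with s , d , s≤ ← halts p x | t , e , t≤ ← halts q (f x) =
    _ , ⇓seq d e , s≤s (+-mono-≤ s≤ (≤-trans t≤ (≤-trans (eval-mono (bound q) (size-output p x))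
      (≤-reflexive (sym (eval-⟪⟫ (bound q) (bound p) _))))))

opaque

  ⟨_,_⟩ : ∀ {f g} → PT A B f → PT A C g → PT A (B ⊗ C) (λ x → f x , g x)
  ⟨ p , q ⟩ .prog    = pair (prog p) (prog q)
  ⟨ p , q ⟩ .bound   = κ 1 ⊞ (X ⊞ (bound p ⊞ bound q))
  ⟨_,_⟩ {A = A} p q .halts x with s , d , s≤ ← halts p x | t , e , t≤ ← halts q x =
    _ , ⇓pair d e , s≤s (+-monoʳ-≤ (size A x) (+-mono-≤ s≤ t≤))

opaque

  branch : ∀ {f g} → PT (A ⊗ Γ) C f → PT (B ⊗ Γ) C g →
           PT ((A ⊕ B) ⊗ Γ) C (λ (s , γ) → [ (λ a → f (a , γ)) , (λ b → g (b , γ)) ]′ s)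
  branch p q .prog  = case (prog p) (prog q)
  branch p q .bound = κ 1 ⊞ (X ⊞ (bound p ⊞ bound q))
  branch p q .halts (inj₁ a , γ) with t , d , t≤ ← halts p (a , γ) =
    _ , ⇓inj₁ d , s≤s (+-monoʳ-≤ _ (≤-trans t≤ (≤-trans (eval-mono (bound p) (n≤1+n _)) (m≤m+n _ _))))
  branch p q .halts (inj₂ b , γ) with t , d , t≤ ← halts q (b , γ) =
    _ , ⇓inj₂ d , s≤s (+-monoʳ-≤ _ (≤-trans t≤ (≤-trans (eval-mono (bound q) (n≤1+n _)) (m≤n+m _ _))))

π₁ : PT (A ⊗ B) A proj₁
π₁ = basic fst

π₂ : PT (A ⊗ B) B proj₂
π₂ = basic snd

identity : PT A A id
identity = basic idₚ

literal : ∀ n → PT A nat (const n)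
literal n = basic (lit n)

-- Loops over lists

module _ {step} (p : PT (A ⊗ (B ⊗ Γ)) B step) where

  opaque
    loopBody : PT (list A ⊗ (B ⊗ Γ)) ((list A ⊗ (B ⊗ Γ)) ⊕ B)
      (λ (zs , (b , γ)) → [ (λ _ → inj₂ b) , (λ (z , zs) → inj₁ (zs , (step (z , (b , γ)) , γ))) ]′ (run uncons zs))
    loopBody = branch
        (basic inr ⊚ π₁ ⊚ π₂)
        (basic inl ⊚ ⟨ π₂ ⊚ π₁ , ⟨ p ⊚ ⟨ π₁ ⊚ π₁ , π₂ ⟩ , π₂ ⊚ π₂ ⟩ ⟩)
      ⊚ ⟨ basic uncons ⊚ π₁ , π₂ ⟩

  -- A polynomial-time step alone does not make a loop polynomial, since the accumulator may grow in
  -- every round. The invariant has two tasks: it bounds all states by the same `N`, and at the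
  -- empty list it identifies the result.
  loop-halts : ∀ (Inv : List ⟦ A ⟧ → ⟦ B ⟧ → Set) γ N →
               (∀ z zs b → Inv (z ∷ zs) b → Inv zs (step (z , (b , γ)))) →
               (∀ zs b → Inv zs b → size (list A ⊗ (B ⊗ Γ)) (zs , (b , γ)) ≤ N) →
               ∀ zs b → Inv zs b →
               ∃₂ λ b′ t → Inv [] b′ × iter (prog loopBody) ⊢ (zs , (b , γ)) ⇓ b′ [ t ] ×
                           t ≤ suc (length zs) * suc (eval (bound loopBody) N)
  loop-halts Inv γ N next small []       b inv with t , d , t≤ ← halts loopBody ([] , (b , γ)) =
    b , _ , inv , ⇓done d , ≤-trans (s≤s (≤-trans t≤ (eval-mono (bound loopBody) (small [] b inv)))) (m≤m+n _ _)
  loop-halts Inv γ N next small (z ∷ zs) b inv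
    with t , d , t≤ ← halts loopBody (z ∷ zs , (b , γ))
       | b′ , t′ , inv′ , d′ , t′≤ ← loop-halts Inv γ N next small zs _ (next z zs b inv) =
    b′ , _ , inv′ , ⇓more d d′ , s≤s (+-mono-≤ (≤-trans t≤ (eval-mono (bound loopBody) (small (z ∷ zs) b inv))) t′≤)

opaque

  -- A loop consumes its list from the front, whereas a right fold starts at the back; reversing
  -- first reconciles the two. The invariant shows that entries merely move from one list to the
  -- other, so the state keeps its size.
  reversal : PT (list A) (list A) reverse
  reversal {A} = record { prog = prog init ⨾ iter (prog (loopBody consStep)) ; bound = cost ; halts = go }
    where
    init : PT (list A) (list A ⊗ (list A ⊗ unit)) (λ xs → xs , ([] , tt))
    init = ⟨ identity , ⟨ basic nil , basic unitₚ ⟩ ⟩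
    consStep : PT (A ⊗ (list A ⊗ unit)) (list A) (λ (x , (acc , _)) → x ∷ acc)
    consStep = basic cons ⊚ ⟨ π₁ {A} , π₁ {list A} {unit} ⊚ π₂ ⟩
    cost : Poly
    cost = κ 1 ⊞ (bound init ⊞ (κ 1 ⊞ X) ⊠ (κ 1 ⊞ bound (loopBody consStep) ⟪ X ⊞ κ 4 ⟫))
    shuffle : ∀ a b → suc (suc a + suc (suc b + 1)) ≡ suc (a + b) + 4
    shuffle = solve-∀
    go : ∀ xs → ∃[ t ] (prog init ⨾ iter (prog (loopBody consStep)) ⊢ xs ⇓ reverse xs [ t ] ×
                   t ≤ eval cost (size (list A) xs))
    go xs with s , d , s≤ ← halts init xs
      with _ , t , refl , e , t≤ ← loop-halts consStep (λ zs acc → zs ʳ++ acc ≡ reverse xs) tt (size (list A) xs + 4)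
             (λ _ _ _ → id)
             (λ zs acc inv → ≤-reflexive (trans (shuffle (lsize A zs) (lsize A acc))
               (cong (λ n → suc n + 4) (trans (sym (lsize-ʳ++ A zs acc))
                 (trans (cong (lsize A) inv) (trans (lsize-ʳ++ A xs []) (+-identityʳ _)))))))
             xs [] refl
      = _ , ⇓seq d e , s≤s (+-mono-≤ s≤ (≤-trans t≤ (*-mono-≤ (s≤s (m≤n⇒m≤1+n (length≤lsize A xs)))
          (s≤s (≤-reflexive (sym (eval-⟪⟫ (bound (loopBody consStep)) (X ⊞ κ 4) _)))))))

module _ {step} (p : PT (A ⊗ (B ⊗ Γ)) B step) (Q : Poly) where

  private
    fold : List ⟦ A ⟧ → ⟦ B ⟧ → ⟦ Γ ⟧ → ⟦ B ⟧
    fold xs b γ = foldr (λ x acc → step (x , (acc , γ))) b xs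

  opaque
    -- The accumulators of the loop are the folds of the suffixes of the list, hence it suffices to
    -- bound the size of the result of a fold.
    foldrPT : (∀ xs b γ → size B (fold xs b γ) ≤ eval Q (size (list A ⊗ (B ⊗ Γ)) (xs , (b , γ)))) →
              PT (list A ⊗ (B ⊗ Γ)) B (λ (xs , (b , γ)) → fold xs b γ)
    foldrPT small = record
      { prog  = prog init ⨾ iter (prog (loopBody p))
      ; bound = cost
      ; halts = λ (xs , (b , γ)) → go xs b γ
      }
      where
      init : PT (list A ⊗ (B ⊗ Γ)) (list A ⊗ (B ⊗ Γ)) (λ (xs , (b , γ)) → reverse xs , (b , γ))
      init = ⟨ reversal ⊚ π₁ , π₂ ⟩
      N : Poly
      N = κ 2 ⊞ (X ⊞ (Q ⊞ X))
      cost : Poly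
      cost = κ 1 ⊞ (bound init ⊞ (κ 1 ⊞ X) ⊠ (κ 1 ⊞ bound (loopBody p) ⟪ N ⟫))
      σ : List ⟦ A ⟧ → ⟦ B ⟧ → ⟦ Γ ⟧ → ℕ
      σ xs b γ = size (list A ⊗ (B ⊗ Γ)) (xs , (b , γ))
      list≤σ : ∀ xs b γ → lsize A xs ≤ σ xs b γ
      list≤σ xs b γ = m≤n⇒m≤1+n (m≤n⇒m≤1+n (m≤m+n _ _))
      states : ∀ xs b γ zs acc → Σ[ ys ∈ List ⟦ A ⟧ ] (zs ʳ++ ys ≡ xs × acc ≡ fold ys b γ) →
               σ zs acc γ ≤ eval N (σ xs b γ)
      states xs b γ zs _ (ys , eq , refl) = begin
        suc (suc (lsize A zs) + suc (size B (fold ys b γ) + size Γ γ))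
          ≡⟨ shuffle (lsize A zs) (size B (fold ys b γ)) (size Γ γ) ⟩
        2 + (suc (lsize A zs) + (size B (fold ys b γ) + size Γ γ))
          ≤⟨ +-monoʳ-≤ 2 (+-mono-≤ zs≤ (+-mono-≤ ys≤ γ≤)) ⟩
        eval N (σ xs b γ) ∎
        where
        open ≤-Reasoning
        both : lsize A zs + lsize A ys ≡ lsize A xs
        both = trans (sym (lsize-ʳ++ A zs ys)) (cong (lsize A) eq)
        zs≤ : suc (lsize A zs) ≤ σ xs b γ
        zs≤ = ≤-trans (s≤s (≤-trans (m≤m+n _ (lsize A ys)) (≤-reflexive both))) (≤-trans (m≤m+n _ _) (n≤1+n _))
        ys≤ : size B (fold ys b γ) ≤ eval Q (σ xs b γ)
        ys≤ = ≤-trans (small ys b γ) (eval-mono Q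
          (s≤s (+-monoˡ-≤ _ (s≤s (≤-trans (m≤n+m _ (lsize A zs)) (≤-reflexive both))))))
        γ≤ : size Γ γ ≤ σ xs b γ
        γ≤ = m≤n⇒m≤1+n (≤-trans (m≤n⇒m≤1+n (m≤n+m _ (size B b))) (m≤n+m _ (suc (lsize A xs))))
        shuffle : ∀ a b c → suc (suc a + suc (b + c)) ≡ 2 + (suc a + (b + c))
        shuffle = solve-∀
      go : ∀ xs b γ → ∃[ t ] (prog init ⨾ iter (prog (loopBody p)) ⊢ (xs , (b , γ)) ⇓ fold xs b γ [ t ] ×
                              t ≤ eval cost (σ xs b γ))
      go xs b γ with s , d , s≤ ← halts init (xs , (b , γ))
        with _ , t , (_ , refl , refl) , e , t≤ ← loop-halts p
               (λ zs acc → Σ[ ys ∈ List ⟦ A ⟧ ] (zs ʳ++ ys ≡ xs × acc ≡ fold ys b γ)) γ (eval N (σ xs b γ))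
               (λ { z zs _ (ys , eq , refl) → z ∷ ys , eq , refl }) (states xs b γ)
               (reverse xs) b ([] , reverse-involutive xs , refl)
        = _ , ⇓seq d e , s≤s (+-mono-≤ s≤ (≤-trans t≤ (*-mono-≤
            (s≤s (≤-trans (length≤lsize A (reverse xs))
              (≤-trans (≤-reflexive (trans (lsize-ʳ++ A xs []) (+-identityʳ _))) (list≤σ xs b γ))))
            (s≤s (≤-reflexive (sym (eval-⟪⟫ (bound (loopBody p)) N _)))))))

-- Tests and arithmetic

𝔹 : Ty
𝔹 = unit ⊕ unit

bit : Bool → ⟦ 𝔹 ⟧
bit b = if b then inj₁ tt else inj₂ tt

TestPT : (A : Ty) → (⟦ A ⟧ → Bool) → Set
TestPT A p = PT A 𝔹 (bit ∘ p)

opaque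

  ifPT : ∀ {p f g} → TestPT A p → PT A B f → PT A B g → PT A B (λ x → if p x then f x else g x)
  ifPT {p = p} {f} {g} test yes-branch no-branch =
    ext (branch (yes-branch ⊚ π₂) (no-branch ⊚ π₂) ⊚ ⟨ test , identity ⟩) λ x → select (p x) x
    where
    select : ∀ b x → [ (λ _ → f x) , (λ _ → g x) ]′ (bit b) ≡ (if b then f x else g x)
    select true  _ = refl
    select false _ = refl

opaque

  ∧PT : ∀ {p q} → TestPT A p → TestPT A q → TestPT A (λ x → p x ∧ q x)
  ∧PT {p = p} {q} P Q = ext (ifPT P Q (basic inr ⊚ basic unitₚ)) λ x → select (p x) (q x)
    where
    select : ∀ a b → (if a then bit b else inj₂ tt) ≡ bit (a ∧ b)
    select true  _ = refl
    select false _ = refl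

opaque

  ∨PT : ∀ {p q} → TestPT A p → TestPT A q → TestPT A (λ x → p x ∨ q x)
  ∨PT {p = p} {q} P Q = ext (ifPT P (basic inl ⊚ basic unitₚ) Q) λ x → select (p x) (q x)
    where
    select : ∀ a b → (if a then inj₁ tt else bit b) ≡ bit (a ∨ b)
    select true  _ = refl
    select false _ = refl

opaque

  ≡ᵇPT : ∀ {f g} → PT A nat f → PT A nat g → TestPT A (λ x → f x ≡ᵇ g x)
  ≡ᵇPT {f = f} {g} F G = ext
    (basic isZero ⊚ basic add ⊚ ⟨ basic monus ⊚ ⟨ F , G ⟩ , basic monus ⊚ ⟨ G , F ⟩ ⟩)
    λ x → correct (f x) (g x)
    where
    correct : ∀ m n → run isZero ((m ∸ n) + (n ∸ m)) ≡ bit (m ≡ᵇ n)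
    correct zero    zero    = refl
    correct zero    (suc n) = refl
    correct (suc m) zero    = refl
    correct (suc m) (suc n) = correct m n

opaque

  <ᵇPT : ∀ {f g} → PT A nat f → PT A nat g → TestPT A (λ x → f x <ᵇ g x)
  <ᵇPT {f = f} {g} F G = ext
    (basic isZero ⊚ basic monus ⊚ ⟨ basic add ⊚ ⟨ literal 1 , F ⟩ , G ⟩)
    λ x → correct (f x) (g x)
    where
    correct : ∀ m n → run isZero (suc m ∸ n) ≡ bit (m <ᵇ n)
    correct m       zero          = refl
    correct zero    (suc zero)    = refl
    correct zero    (suc (suc n)) = refl
    correct (suc m) (suc n)       = correct m n

isTrue : ⟦ 𝔹 ⟧ → Bool
isTrue = [ const true , const false ]′

opaque

  isTruePT : TestPT 𝔹 isTrue
  isTruePT = ext identity λ { (inj₁ _) → refl ; (inj₂ _) → refl }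

opaque

  -- Multiplication is not primitive, but the factor is fixed together with the program, so it
  -- unrolls into n additions. Only multiples by constants depending on c are needed.
  scalePT : ∀ n → PT nat nat (n *_)
  scalePT zero    = literal 0
  scalePT (suc n) = basic add ⊚ ⟨ identity , scalePT n ⟩

opaque

  -- List functions

  appendPT : ∀ {f g} → PT A (list B) f → PT A (list B) g → PT A (list B) (λ x → f x ++ g x)
  appendPT {B = B} {f = f} {g} F G = ext
    (foldrPT {Γ = unit} (basic cons ⊚ ⟨ π₁ , π₁ ⊚ π₂ ⟩) X small ⊚ ⟨ F , ⟨ G , basic unitₚ ⟩ ⟩)
    λ x → foldr-∷ (f x) (g x)
    where
    foldr-∷ : ∀ (xs ys : List ⟦ B ⟧) → foldr _∷_ ys xs ≡ xs ++ ys
    foldr-∷ []       ys = refl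
    foldr-∷ (x ∷ xs) ys = cong (x ∷_) (foldr-∷ xs ys)
    small : ∀ xs ys γ → size (list B) (foldr _∷_ ys xs) ≤ size (list B ⊗ (list B ⊗ unit)) (xs , (ys , γ))
    small xs ys γ = ≤-trans
      (≤-reflexive (cong suc (trans (cong (lsize B) (foldr-∷ xs ys)) (lsize-++ B xs ys))))
      (s≤s (+-mono-≤ (n≤1+n _) (≤-trans (m≤m+n _ 1) (≤-trans (n≤1+n _) (n≤1+n _)))))

opaque

  -- Each block is written by `F` on an input no larger than the whole state, so its size is at most
  -- the time bound of `F` there, and the number of blocks is at most the size of the state.
  concatMapPT : ∀ {f} → PT (A ⊗ Γ) (list B) f →
                PT (list A ⊗ Γ) (list B) (λ (xs , γ) → concatMap (λ x → f (x , γ)) xs)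
  concatMapPT {A} {Γ} {B} {f} F = ext
    (foldrPT (appendPT (F ⊚ ⟨ π₁ , π₂ ⊚ π₂ ⟩) (π₁ ⊚ π₂)) (X ⊠ bound F ⊞ X) small ⊚ ⟨ π₁ , ⟨ basic nil , π₂ ⟩ ⟩)
    λ (xs , γ) → fused γ xs
    where
    step : ⟦ Γ ⟧ → ⟦ A ⟧ → List ⟦ B ⟧ → List ⟦ B ⟧
    step γ x acc = f (x , γ) ++ acc
    fused : ∀ γ xs → foldr (step γ) [] xs ≡ concatMap (λ x → f (x , γ)) xs
    fused γ []       = refl
    fused γ (x ∷ xs) = cong (f (x , γ) ++_) (fused γ xs)
    total : ∀ N γ b xs → suc (lsize A xs + size Γ γ) ≤ N →
            lsize B (foldr (step γ) b xs) ≤ length xs * eval (bound F) N + lsize B b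
    total N γ b []       _  = ≤-refl
    total N γ b (x ∷ xs) ≤N = begin
      lsize B (f (x , γ) ++ foldr (step γ) b xs)
        ≡⟨ lsize-++ B (f (x , γ)) _ ⟩
      lsize B (f (x , γ)) + lsize B (foldr (step γ) b xs)
        ≤⟨ +-mono-≤
             first≤
             (total N γ b xs (≤-trans (s≤s (+-monoˡ-≤ (size Γ γ) (m≤n+m (lsize A xs) (suc (size A x))))) ≤N)) ⟩
      eval (bound F) N + (length xs * eval (bound F) N + lsize B b)
        ≡⟨ +-assoc (eval (bound F) N) _ _ ⟨
      length (x ∷ xs) * eval (bound F) N + lsize B b ∎
      where
      open ≤-Reasoning
      first≤ : lsize B (f (x , γ)) ≤ eval (bound F) N
      first≤ = ≤-trans (n≤1+n _) (≤-trans (size-output F (x , γ)) (eval-mono (bound F)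
        (≤-trans (s≤s (+-monoˡ-≤ (size Γ γ) (≤-trans (n≤1+n (size A x)) (m≤m+n _ (lsize A xs))))) ≤N)))
    small : ∀ xs b γ → size (list B) (foldr (step γ) b xs) ≤
            eval (X ⊠ bound F ⊞ X) (size (list A ⊗ (list B ⊗ Γ)) (xs , (b , γ)))
    small xs b γ = ≤-trans
      (s≤s (total σ γ b xs (s≤s (+-mono-≤ (n≤1+n _) (≤-trans (m≤n+m _ (suc (lsize B b))) (n≤1+n _))))))
      (≤-trans (≤-reflexive (sym (+-suc _ _)))
        (+-mono-≤ (*-monoˡ-≤ (eval (bound F) σ) (≤-trans (length≤lsize A xs) (m≤n⇒m≤1+n (m≤n⇒m≤1+n (m≤m+n _ _)))))
                  (m≤n⇒m≤1+n (≤-trans (m≤m+n _ (size Γ γ)) (≤-trans (n≤1+n _) (m≤n+m _ (suc (lsize A xs))))))))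
      where
      σ : ℕ
      σ = size (list A ⊗ (list B ⊗ Γ)) (xs , (b , γ))

opaque

  singletonPT : ∀ {f} → PT A B f → PT A (list B) (λ x → [ f x ])
  singletonPT F = basic cons ⊚ ⟨ F , basic nil ⟩

opaque

  mapPT : ∀ {f} → PT (A ⊗ Γ) B f → PT (list A ⊗ Γ) (list B) (λ (xs , γ) → map (λ x → f (x , γ)) xs)
  mapPT {A = A} {Γ = Γ} {f = f} F = ext (concatMapPT (singletonPT F)) λ (xs , γ) → fused γ xs
    where
    fused : ∀ γ xs → concatMap (λ x → [ f (x , γ) ]) xs ≡ map (λ x → f (x , γ)) xs
    fused γ []       = refl
    fused γ (x ∷ xs) = cong (f (x , γ) ∷_) (fused γ xs)

opaque

  filterPT : {P : ⟦ Γ ⟧ → Pred ⟦ A ⟧ 0ℓ} (P? : ∀ γ → Decidable (P γ)) → TestPT (A ⊗ Γ) (λ (x , γ) → does (P? γ x)) →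
             PT (list A ⊗ Γ) (list A) (λ (xs , γ) → filter (P? γ) xs)
  filterPT P? test = ext {g = λ (xs , γ) → filter (P? γ) xs}
    (concatMapPT (ifPT test (singletonPT π₁) (basic nil))) λ (xs , γ) → fused γ xs
    where
    fused : ∀ γ xs → concatMap (λ x → if does (P? γ x) then [ x ] else []) xs ≡ filter (P? γ) xs
    fused γ []       = refl
    fused γ (x ∷ xs) with does (P? γ x)
    ... | true  = cong (x ∷_) (fused γ xs)
    ... | false = fused γ xs

opaque

  anyPT : {P : ⟦ Γ ⟧ → Pred ⟦ A ⟧ 0ℓ} (P? : ∀ γ → Decidable (P γ)) → TestPT (A ⊗ Γ) (λ (x , γ) → does (P? γ x)) →
          TestPT (list A ⊗ Γ) (λ (xs , γ) → does (any? (P? γ) xs))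
  anyPT {Γ} {A} P? test = ext {g = λ (xs , γ) → bit (does (any? (P? γ) xs))}
    (foldrPT (ifPT (test ⊚ ⟨ π₁ , π₂ ⊚ π₂ ⟩) (basic inl ⊚ basic unitₚ) (π₁ ⊚ π₂)) (κ 2) (λ xs b γ → size-𝔹 _)
      ⊚ ⟨ π₁ , ⟨ basic inr ⊚ basic unitₚ , π₂ ⟩ ⟩)
    λ (xs , γ) → fused γ xs
    where
    size-𝔹 : ∀ b → size 𝔹 b ≤ 2
    size-𝔹 (inj₁ _) = ≤-refl
    size-𝔹 (inj₂ _) = ≤-refl
    fused : ∀ γ xs → foldr (λ x acc → if does (P? γ x) then inj₁ tt else acc) (inj₂ tt) xs ≡
            bit (does (any? (P? γ) xs))
    fused γ []       = refl
    fused γ (x ∷ xs) with does (P? γ x)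
    ... | true  = refl
    ... | false = fused γ xs

opaque

  lengthPT : PT (list A) nat length
  lengthPT {A} = foldrPT {Γ = unit} (basic add ⊚ ⟨ literal 1 , π₁ ⊚ π₂ ⟩) (κ 1 ⊞ X) small
      ⊚ ⟨ identity , ⟨ literal 0 , basic unitₚ ⟩ ⟩
    where
    log-fold : ∀ xs b → ⌊log₂ (foldr (λ _ → suc) b xs) ⌋ ≤ lsize A xs + ⌊log₂ b ⌋
    log-fold []       b = ≤-refl
    log-fold (x ∷ xs) b = ≤-trans (⌊log₂⌋-+ 1 (foldr (λ _ → suc) b xs))
      (s≤s (≤-trans (log-fold xs b) (+-monoˡ-≤ _ (m≤n+m _ (size A x)))))
    small : ∀ xs b γ → size nat (foldr (λ _ → suc) b xs) ≤ 1 + size (list A ⊗ (nat ⊗ unit)) (xs , (b , γ))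
    small xs b γ = s≤s (≤-trans (log-fold xs b) (≤-trans
      (+-mono-≤ (n≤1+n _) (≤-trans (n≤1+n _) (≤-trans (m≤m+n _ 1) (n≤1+n _)))) (n≤1+n _)))

enumerate : {X : Set} → List X → List (ℕ × X)
enumerate []       = []
enumerate (x ∷ xs) = (0 , x) ∷ map (λ (n , y) → suc n , y) (enumerate xs)

opaque

  -- The size is at most quadratic: every round lengthens each existing index by at most one bit and
  -- adds a single entry whose index and pairing cost two units.
  enumeratePT : PT (list A) (list (nat ⊗ A)) enumerate
  enumeratePT {A} = ext
    (foldrPT {Γ = unit}
      (basic cons ⊚ ⟨ ⟨ literal 0 , π₁ ⟩ , mapPT {Γ = unit} (⟨ basic add ⊚ ⟨ literal 1 , π₁ ⊚ π₁ ⟩ , π₂ ⊚ π₁ ⟩) ⊚ π₂ ⟩)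
      (X ⊞ X ⊠ (κ 2 ⊞ X)) small
     ⊚ ⟨ identity , ⟨ basic nil , basic unitₚ ⟩ ⟩)
    fused
    where
    next : List (ℕ × ⟦ A ⟧) → List (ℕ × ⟦ A ⟧)
    next = map (λ (n , y) → suc n , y)
    enumerateOnto : List (ℕ × ⟦ A ⟧) → List ⟦ A ⟧ → List (ℕ × ⟦ A ⟧)
    enumerateOnto = foldr (λ x acc → (0 , x) ∷ next acc)
    fused : ∀ xs → enumerateOnto [] xs ≡ enumerate xs
    fused []       = refl
    fused (x ∷ xs) = cong (λ acc → (0 , x) ∷ next acc) (fused xs)
    length-onto : ∀ b xs → length (enumerateOnto b xs) ≡ length xs + length b
    length-onto b []       = refl
    length-onto b (x ∷ xs) = cong suc (trans (length-map _ (enumerateOnto b xs)) (length-onto b xs))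
    lsize-next : ∀ ys → lsize (nat ⊗ A) (next ys) ≤ length ys + lsize (nat ⊗ A) ys
    lsize-next []             = z≤n
    lsize-next ((n , y) ∷ ys) = ≤-trans
      (+-mono-≤ (s≤s (s≤s (s≤s (+-monoˡ-≤ (size A y) (⌊log₂⌋-+ 1 n))))) (lsize-next ys))
      (≤-reflexive (shuffle ⌊log₂ n ⌋ (size A y) (length ys) (lsize (nat ⊗ A) ys)))
      where
      shuffle : ∀ l a n s → suc (suc (suc (suc (l + a)))) + (n + s) ≡ suc n + (suc (suc (suc l + a)) + s)
      shuffle = solve-∀
    lsize-onto : ∀ N b xs → length xs + length b ≤ N →
                 lsize (nat ⊗ A) (enumerateOnto b xs) ≤ lsize A xs + lsize (nat ⊗ A) b + length xs * (2 + N)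
    lsize-onto N b []       _  = m≤m+n _ 0
    lsize-onto N b (x ∷ xs) ≤N = begin
      3 + size A x + lsize (nat ⊗ A) (next ys)
        ≤⟨ +-monoʳ-≤ (3 + size A x) (lsize-next ys) ⟩
      3 + size A x + (length ys + lsize (nat ⊗ A) ys)
        ≤⟨ +-monoʳ-≤ (3 + size A x) (+-mono-≤ (≤-trans (≤-reflexive (length-onto b xs)) (≤-trans (n≤1+n _) ≤N))
             (lsize-onto N b xs (≤-trans (n≤1+n _) ≤N))) ⟩
      3 + size A x + (N + (lsize A xs + lsize (nat ⊗ A) b + length xs * (2 + N)))
        ≡⟨ shuffle (size A x) N (lsize A xs) (lsize (nat ⊗ A) b) (length xs * (2 + N)) ⟩
      suc (size A x) + lsize A xs + lsize (nat ⊗ A) b + (2 + N + length xs * (2 + N)) ∎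
      where
      open ≤-Reasoning
      ys : List (ℕ × ⟦ A ⟧)
      ys = enumerateOnto b xs
      shuffle : ∀ a n l b r → 3 + a + (n + (l + b + r)) ≡ suc a + l + b + (2 + n + r)
      shuffle = solve-∀
    small : ∀ xs b γ → size (list (nat ⊗ A)) (enumerateOnto b xs) ≤
            eval (X ⊞ X ⊠ (κ 2 ⊞ X)) (size (list A ⊗ (list (nat ⊗ A) ⊗ unit)) (xs , (b , γ)))
    small xs b γ = ≤-trans
      (s≤s (lsize-onto σ b xs (≤-trans (+-mono-≤ (length≤lsize A xs) (length≤lsize (nat ⊗ A) b)) lists≤σ)))
      (+-mono-≤ (≤-trans (s≤s (+-mono-≤ (n≤1+n (lsize A xs)) (≤-trans (n≤1+n _) (n≤1+n _))))
                  (s≤s (+-monoʳ-≤ (suc (lsize A xs)) (s≤s (m≤m+n (suc (lsize (nat ⊗ A) b)) 1)))))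
                (*-monoˡ-≤ (2 + σ) (≤-trans (length≤lsize A xs) (≤-trans (m≤m+n _ _) lists≤σ))))
      where
      σ : ℕ
      σ = size (list A ⊗ (list (nat ⊗ A) ⊗ unit)) (xs , (b , γ))
      lists≤σ : lsize A xs + lsize (nat ⊗ A) b ≤ σ
      lists≤σ = m≤n⇒m≤1+n (+-mono-≤ (n≤1+n _) (≤-trans (n≤1+n _) (≤-trans (m≤m+n _ 1) (n≤1+n _))))

-- The kernelization as a program

edgeTy : Ty
edgeTy = nat ⊗ nat

opaque

  endsPT : PT (list edgeTy) (list nat) ends
  endsPT = concatMapPT {Γ = unit} (basic cons ⊚ ⟨ π₁ ⊚ π₁ , singletonPT (π₂ ⊚ π₁) ⟩) ⊚ ⟨ identity , basic unitₚ ⟩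

opaque

  degPT : ∀ {A f g} → PT A (list edgeTy) f → PT A nat g → PT A nat (λ x → deg (f x) (g x))
  degPT F G = lengthPT ⊚ filterPT {Γ = nat} (λ v x → x ≟ v) (≡ᵇPT π₁ π₂) ⊚ ⟨ endsPT ⊚ F , G ⟩

opaque

  -- `does (keep? D M K e)` computes to a conjunction of Boolean comparisons, and the tests are
  -- nested in the same way.
  keepPT : TestPT (edgeTy ⊗ (list edgeTy ⊗ (nat ⊗ nat))) (λ (e , (K , (D , M))) → does (keep? D M K e))
  keepPT = ∧PT (<ᵇPT (degPT (π₁ ⊚ π₂) (π₁ ⊚ π₁)) (π₁ ⊚ π₂ ⊚ π₂))
          (∧PT (<ᵇPT (degPT (π₁ ⊚ π₂) (π₂ ⊚ π₁)) (π₁ ⊚ π₂ ⊚ π₂))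
               (<ᵇPT (lengthPT ⊚ π₁ ⊚ π₂) (π₂ ⊚ π₂ ⊚ π₂)))

opaque

  addPT : PT (edgeTy ⊗ (list edgeTy ⊗ (nat ⊗ nat))) (list edgeTy) (λ (e , (K , (D , M))) → tryAdd D M e K)
  addPT = ifPT keepPT (basic cons ⊚ ⟨ π₁ , π₁ ⊚ π₂ ⟩) (π₁ ⊚ π₂)

opaque

  greedyPT : PT (list edgeTy ⊗ (nat ⊗ nat)) (list edgeTy) (λ (E , (D , M)) → greedy D M E)
  greedyPT = foldrPT addPT X small ⊚ ⟨ π₁ , ⟨ basic nil , π₂ ⟩ ⟩
    where
    -- Only entries of the input are ever added, whatever list `K` the fold starts from.
    lsize-greedy : ∀ D M K E → lsize edgeTy (foldr (tryAdd D M) K E) ≤ lsize edgeTy E + lsize edgeTy K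
    lsize-greedy D M K []      = ≤-refl
    lsize-greedy D M K (e ∷ E) = tryAdd-elim (λ K′ → lsize edgeTy K′ ≤ lsize edgeTy (e ∷ E) + lsize edgeTy K)
      D M e (foldr (tryAdd D M) K E)
      (λ _ → ≤-trans (+-monoʳ-≤ (suc (size edgeTy e)) (lsize-greedy D M K E))
                     (≤-reflexive (sym (+-assoc (suc (size edgeTy e)) _ _))))
      (λ _ → ≤-trans (lsize-greedy D M K E) (+-monoˡ-≤ _ (m≤n+m _ (suc (size edgeTy e)))))
    small : ∀ E K ((D , M) : ℕ × ℕ) → size (list edgeTy) (foldr (tryAdd D M) K E) ≤
            size (list edgeTy ⊗ (list edgeTy ⊗ (nat ⊗ nat))) (E , (K , (D , M)))
    small E K (D , M) = s≤s (≤-trans (lsize-greedy D M K E)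
      (+-mono-≤ (n≤1+n _) (≤-trans (n≤1+n _) (≤-trans (m≤m+n _ (size (nat ⊗ nat) (D , M))) (n≤1+n _)))))

rowEdges : ℕ → List (ℕ × ⟦ 𝔹 ⟧) → List Edge
rowEdges u = concatMap (λ (v , b) → if (u <ᵇ v) ∧ isTrue b then [ (u , v) ] else [])

matrixEdges : List (List ⟦ 𝔹 ⟧) → List Edge
matrixEdges rows = concatMap (λ (u , row) → rowEdges u (enumerate row)) (enumerate rows)

opaque

  rowEdgesPT : PT (list (nat ⊗ 𝔹) ⊗ nat) (list edgeTy) (λ (row , u) → rowEdges u row)
  rowEdgesPT = concatMapPT (ifPT (∧PT (<ᵇPT π₂ (π₁ ⊚ π₁)) (isTruePT ⊚ π₂ ⊚ π₁))
    (singletonPT ⟨ π₂ , π₁ ⊚ π₁ ⟩) (basic nil))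

opaque

  matrixEdgesPT : PT (list (list 𝔹)) (list edgeTy) matrixEdges
  matrixEdgesPT = concatMapPT {Γ = unit} (rowEdgesPT ⊚ ⟨ enumeratePT ⊚ π₂ ⊚ π₁ , π₁ ⊚ π₁ ⟩)
    ⊚ ⟨ enumeratePT , basic unitₚ ⟩

opaque

  sparsifyPT : ∀ c → PT (list (list 𝔹) ⊗ nat) (list edgeTy) (λ (rows , k) → sparsify c k (matrixEdges rows))
  sparsifyPT c = greedyPT ⊚ ⟨ matrixEdgesPT ⊚ π₁ , ⟨ scalePT (degreeCap c) ⊚ π₂ , scalePT (edgeCap c) ⊚ π₂ ⟩ ⟩

opaque

  labelsPT : PT (list (list 𝔹)) (list nat) (map proj₁ ∘ enumerate)
  labelsPT = mapPT {Γ = unit} (π₁ ⊚ π₁) ⊚ ⟨ enumeratePT , basic unitₚ ⟩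

opaque

  nonIsolatedPT : PT (list nat ⊗ list edgeTy) (list nat) (λ (vs , K) → filter (λ v → 0 <? deg K v) vs)
  nonIsolatedPT = filterPT (λ K v → 0 <? deg K v) (<ᵇPT (literal 0) (degPT π₂ π₁))

opaque

  joinedPT : TestPT (list edgeTy ⊗ (nat ⊗ nat)) (λ (K , (u , v)) → does (joined? K u v))
  joinedPT = anyPT {Γ = nat ⊗ nat} (λ (u , v) → joins? u v)
    (∨PT (∧PT (≡ᵇPT (π₁ ⊚ π₁) (π₁ ⊚ π₂)) (≡ᵇPT (π₂ ⊚ π₁) (π₂ ⊚ π₂)))
         (∧PT (≡ᵇPT (π₁ ⊚ π₁) (π₂ ⊚ π₂)) (≡ᵇPT (π₂ ⊚ π₁) (π₁ ⊚ π₂))))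

adjacencyMatrix : List Edge → List ℕ → List (List ⟦ 𝔹 ⟧)
adjacencyMatrix K vs = map (λ u → map (λ v → bit (does (joined? K u v))) vs) vs

opaque

  rowPT : PT (list nat ⊗ (list edgeTy ⊗ nat)) (list 𝔹) (λ (vs , (K , u)) → map (λ v → bit (does (joined? K u v))) vs)
  rowPT = mapPT (joinedPT ⊚ ⟨ π₁ ⊚ π₂ , ⟨ π₂ ⊚ π₂ , π₁ ⟩ ⟩)

opaque

  adjacencyMatrixPT : PT (list edgeTy ⊗ list nat) (list (list 𝔹)) (λ (K , vs) → adjacencyMatrix K vs)
  adjacencyMatrixPT = mapPT (rowPT ⊚ ⟨ π₂ ⊚ π₂ , ⟨ π₁ ⊚ π₂ , π₁ ⟩ ⟩) ⊚ ⟨ π₂ , identity ⟩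

kernelCode : ℕ → ⟦ InstTy ⟧ → ⟦ InstTy ⟧
kernelCode c (rows , k) =
  adjacencyMatrix K (filter (λ v → 0 <? deg K v) (map proj₁ (enumerate rows))) , k
  where
  K = sparsify c k (matrixEdges rows)

opaque

  kernelPT : ∀ c → PT InstTy InstTy (kernelCode c)
  kernelPT c = ⟨ adjacencyMatrixPT ⊚ ⟨ sparsifyPT c , nonIsolatedPT ⊚ ⟨ labelsPT ⊚ π₁ , sparsifyPT c ⟩ ⟩ , π₂ ⟩

-- The program outputs the encoded kernel

enumerate-tabulate : ∀ {A : Set} {n} (g : Fin n → A) → enumerate (tabulate g) ≡ map (λ i → toℕ i , g i) (allFin n)
enumerate-tabulate g = trans (tabulated g) (sym (map-tabulate id _))
  where
  tabulated : ∀ {A : Set} {n} (g : Fin n → A) → enumerate (tabulate g) ≡ tabulate (λ i → toℕ i , g i)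
  tabulated {n = zero}  g = refl
  tabulated {n = suc n} g = cong (_ ∷_) (trans (cong (map _) (tabulated (g ∘ Fin.suc))) (map-tabulate _ _))

module _ (G : Graph) where

  private
    n = order G
    row : Fin n → List ⟦ 𝔹 ⟧
    row i = tabulate (λ j → bit (adj G i j))

  rowEdges-adj : ∀ i js → rowEdges (toℕ i) (map (λ j → toℕ j , bit (adj G i j)) js) ≡
                 map (relabel toℕ) (filter (isEdge? G) (map (i ,_) js))
  rowEdges-adj i []       = refl
  rowEdges-adj i (j ∷ js) with IH ← rowEdges-adj i js | toℕ i <ᵇ toℕ j | adj G i j
  ... | true  | true  = cong (_ ∷_) IH
  ... | true  | false = IH
  ... | false | _     = IH

  -- Equality of lists is needed, since the greedy choice depends on the order of the edges and a
  -- permutation could lead to another kernel. Reading the matrix row by row is the order of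
  -- `cartesianProduct`.
  matrixEdges-adj : matrixEdges (tabulate row) ≡ edgeList G
  matrixEdges-adj = trans (cong (concatMap _) (enumerate-tabulate row)) (rows (allFin n))
    where
    rows : ∀ is → concatMap (λ (u , r) → rowEdges u (enumerate r)) (map (λ i → toℕ i , row i) is) ≡
           map (relabel toℕ) (filter (isEdge? G) (cartesianProduct is (allFin n)))
    rows []       = refl
    rows (i ∷ is) = trans
      (cong₂ _++_ (trans (cong (rowEdges (toℕ i)) (enumerate-tabulate (λ j → bit (adj G i j))))
                         (rowEdges-adj i (allFin n)))
                  (rows is))
      (sym (trans (cong (map (relabel toℕ)) (filter-++ (isEdge? G) (map (i ,_) (allFin n)) _))
                  (map-++ (relabel toℕ) (filter (isEdge? G) (map (i ,_) (allFin n))) _)))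

labels-tabulate : ∀ {A : Set} {n} (g : Fin n → A) → map proj₁ (enumerate (tabulate g)) ≡ map toℕ (allFin n)
labels-tabulate {n = n} g = trans (cong (map proj₁) (enumerate-tabulate g))
  (trans (cong (map proj₁) (map-tabulate id _)) (trans (map-tabulate {n = n} _ _) (sym (map-tabulate id toℕ))))

tabulate-lookup-map : ∀ {A B : Set} (h : A → B) xs → tabulate (h ∘ lookup xs) ≡ map h xs
tabulate-lookup-map h xs = trans (sym (map-tabulate (lookup xs) h)) (cong (map h) (tabulate-lookup xs))

module _ (c : ℕ) .{{_ : NonZero c}} where

  -- The matrix of the kernel is tabulated over positions in `vs`, while the program maps over `vs`
  -- itself; `tabulate-lookup-map` identifies the two for rows and for entries.
  encode-reduce : ∀ I → kernelCode c (encode I) ≡ encode (reduceInstance c I)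
  encode-reduce I = cong (_, param I) (trans
    (cong₂ (λ E ls → adjacencyMatrix (sparsify c (param I) E) (filter (λ v → 0 <? deg (sparsify c (param I) E) v) ls))
      (matrixEdges-adj (graph I)) (labels-tabulate {n = order (graph I)} _))
    (sym (trans (tabulate-cong (λ i → tabulate-lookup-map (λ v → bit (does (joined? K (lookup vs i) v))) vs))
                (tabulate-lookup-map (λ u → map (λ v → bit (does (joined? K u v))) vs) vs))))
    where
    K = kernelEdges c I
    vs = nonIsolated K (order (graph I))

  reduce-polyTime : PolyTime (reduceInstance c)
  reduce-polyTime = prog program , a , d , λ I →
    let t , run⇓ , t≤ = halts program (encode I)
    in t , subst (λ y → prog program ⊢ encode I ⇓ y [ t ]) (encode-reduce I) run⇓ ,
       ≤-trans t≤ (bounded′ (size InstTy (encode I)))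
    where
    program = kernelPT c
    monomial = monomial-bound (bound program)
    a = proj₁ monomial
    d = proj₁ (proj₂ monomial)
    bounded′ = proj₂ (proj₂ monomial)

theorem2 : ∀ (c : ℕ) → .{{_ : NonZero c}} →
    (∀ k → f (2 * c) k (2 * c * k) ≡ 16 * c ^ 2 * k ∸ 6 * c * k) ×
    AdmitsKernel c (λ k → f (2 * c) k (2 * c * k))
theorem2 c = f-formula c , record
  { reduce      = reduceInstance c
  ; polyTime    = reduce-polyTime c
  ; equivalent  = reduce-equivalent c
  -- At most 2M vertices and M edges; the summand k covers the unchanged parameter.
  ; g           = λ k → k + 3 * (edgeCap c * k)
  ; param-bound = λ I → m≤m+n (param I) _
  ; size-bound  = λ I → ≤-trans (+-mono-≤ (reduce-order c I) (reduce-edges c I))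
                    (≤-trans (≤-reflexive (+-comm (2 * (edgeCap c * param I)) _)) (m≤n+m _ (param I)))
  ; edge-bound  = λ I → ≤-<-trans (reduce-edges c I) (edgeCap<f c (param I) (1≤k I))
  }
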